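{- The sets of patterns $\{123,1121\}$, $\{132,1211\}$ and $\{213,1121\}$ are pairwise $m$-equivalent, that is, $\{123,1121\}\sim\{132,1211\}\sim\{213,1121\}$.
   Context: A (finite, reduced) multiset is $S=1^{a_1}2^{a_2}\cdots k^{a_k}$ with $k\ge 1$ and all $a_i\ge 1$, meaning that $i$ occurs with multiplicity $a_i$. A multipermutation of $S$ is a word having exactly $a_i$ occurrences of each letter $i\in[k]=\{1,\dots,k\}$ and no other letters. A word $\pi=\pi_1\cdots\pi_n$ contains a pattern (word) $\rho=\rho_1\cdots\rho_\ell$ if there are indices $i(1)<\cdots<i(\ell)$ such that for all $a,b\in[\ell]$: $\pi_{i(a)}<\pi_{i(b)}$ iff $\rho_a<\rho_b$, and $\pi_{i(a)}>\pi_{i(b)}$ iff $\rho_a>\rho_b$; otherwise $\pi$ avoids $\rho$. For a set $P$ of patterns, $\mathrm{av}(S;P)$ is the number of multipermutations of $S$ that avoid every pattern in $P$. Two sets of patterns $P,Q$ are $m$-equivalent, written here $P\sim Q$, if $\mathrm{av}(S;P)=\mathrm{av}(S;Q)$ for every multiset $S$. -}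

module Defs where

open import Data.Fin as Fin using (Fin; toℕ; finToFun; funToFin)
open import Data.Fin.Properties as Fin using (any?; all?; finToFun-funToFin)
open import Data.List using (List; []; _∷_; map; length; lookup; filter; upTo; tabulate; cartesianProductWith)
open import Data.List.Relation.Unary.All as All using (All)
open import Data.Nat using (ℕ; zero; suc; _≤_; _<_; _>_; _≤?_; _<?_; _≟_)
open import Data.Nat.ListAction using (sum)
open import Data.Nat.Properties using (_>?_)
open import Data.Product using (_×_; _,_; ∃-syntax)
open import Function using (_⇔_; mk⇔; Equivalence)
open import Relation.Binary.PropositionalEquality using (_≡_; _≗_; sym; subst₂)
open import Relation.Nullary using (¬_; Dec; ¬?; _×-dec_; _→-dec_)
open import Relation.Nullary.Decidable using (map′)

Word : Set
Word = List ℕ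

-- The letter i ∈ [k] has multiplicity mult j where i = suc (toℕ j),
-- because Fin k counts from 0.
record Multiset : Set where
  field
    k      : ℕ
    k≥1    : 1 ≤ k
    mult   : Fin k → ℕ
    mult≥1 : ∀ j → 1 ≤ mult j

open Multiset

occurrences : ℕ → Word → ℕ
occurrences x π = length (filter (x ≟_) π)

IsMultipermutation : Multiset → Word → Set
IsMultipermutation S π =
  (∀ j → occurrences (suc (toℕ j)) π ≡ mult S j) ×
  All (λ x → 1 ≤ x × x ≤ k S) π

StrictlyIncreasing : ∀ {ℓ n} → (Fin ℓ → Fin n) → Set
StrictlyIncreasing i = ∀ a b → a Fin.< b → i a Fin.< i b

SameOrderAt : (π ρ : Word) → (Fin (length ρ) → Fin (length π)) → Set
SameOrderAt π ρ i = ∀ a b →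
  (lookup π (i a) < lookup π (i b) ⇔ lookup ρ a < lookup ρ b) ×
  (lookup π (i a) > lookup π (i b) ⇔ lookup ρ a > lookup ρ b)

Contains : Word → Word → Set
Contains π ρ = ∃[ i ] (StrictlyIncreasing i × SameOrderAt π ρ i)

Avoids : Word → Word → Set
Avoids π ρ = ¬ Contains π ρ

-- Finite pattern sets are given by listing their elements.
AvoidsAll : List Word → Word → Set
AvoidsAll P π = All (Avoids π) P

isMultipermutation? : ∀ S π → Dec (IsMultipermutation S π)
isMultipermutation? S π =
  all? (λ j → occurrences (suc (toℕ j)) π ≟ mult S j) ×-dec
  All.all? (λ x → (1 ≤? x) ×-dec (x ≤? k S)) π

private
  _⇔?_ : {A B : Set} → Dec A → Dec B → Dec (A ⇔ B)
  a? ⇔? b? = map′ (λ (f , g) → mk⇔ f g) (λ e → Equivalence.to e , Equivalence.from e)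
                  ((a? →-dec b?) ×-dec (b? →-dec a?))

  -- Functions Fin ℓ → Fin n are searched through their codes in Fin (n ^ ℓ);
  -- a predicate invariant under pointwise equality is needed to decode.
  anyFunction? : ∀ {ℓ n} {Q : (Fin ℓ → Fin n) → Set} →
                 (∀ {f g} → f ≗ g → Q f → Q g) →
                 (∀ f → Dec (Q f)) → Dec (∃[ f ] Q f)
  anyFunction? resp Q? =
    map′ (λ (c , q) → finToFun c , q)
         (λ (f , q) → funToFin f , resp (λ a → sym (finToFun-funToFin f a)) q)
         (any? (λ c → Q? (finToFun c)))

contains? : ∀ π ρ → Dec (Contains π ρ)
contains? π ρ = anyFunction? resp dec
  where
  Occ : (Fin (length ρ) → Fin (length π)) → Set
  Occ i = StrictlyIncreasing i × SameOrderAt π ρ i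

  resp : ∀ {f g} → f ≗ g → Occ f → Occ g
  resp f≗g (inc , same) =
    (λ a b a<b → subst₂ Fin._<_ (f≗g a) (f≗g b) (inc a b a<b)) ,
    (λ a b → subst₂ (λ u v →
        (lookup π u < lookup π v ⇔ lookup ρ a < lookup ρ b) ×
        (lookup π u > lookup π v ⇔ lookup ρ a > lookup ρ b))
      (f≗g a) (f≗g b) (same a b))

  dec : ∀ i → Dec (Occ i)
  dec i =
    all? (λ a → all? (λ b → (a Fin.<? b) →-dec (i a Fin.<? i b))) ×-dec
    all? (λ a → all? (λ b →
      ((lookup π (i a) <? lookup π (i b)) ⇔? (lookup ρ a <? lookup ρ b)) ×-dec
      ((lookup π (i a) >? lookup π (i b)) ⇔? (lookup ρ a >? lookup ρ b))))

avoidsAll? : ∀ P π → Dec (AvoidsAll P π)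
avoidsAll? P π = All.all? (λ ρ → ¬? (contains? π ρ)) P

-- All words of length n over [k], each listed once.
words : (k n : ℕ) → List Word
words k zero    = [] ∷ []
words k (suc n) = cartesianProductWith _∷_ (map suc (upTo k)) (words k n)

-- Every multipermutation of S is a word over [k] whose length is the sum of the
-- multiplicities, so filtering these words loses none of them.
multipermutations : Multiset → List Word
multipermutations S =
  filter (isMultipermutation? S) (words (k S) (sum (tabulate (mult S))))

av : Multiset → List Word → ℕ
av S P = length (filter (avoidsAll? P) (multipermutations S))

infix 4 _∼_
_∼_ : List Word → List Word → Set
P ∼ Q = ∀ S → av S P ≡ av S Q

{-# OPTIONS --safe #-}
-- Build the multipermutations by inserting the letters from the largest to the
-- smallest. Call a site of an avoiding word active if a new smallest letter may
-- be inserted there: for 123 the sites followed by a weakly decreasing suffix,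
-- for 132 those followed by a weakly increasing suffix, and for 213 those where
-- every letter before is at least every letter after. The second pattern allows
-- the copies of a new smallest letter to occupy at most two sites (all but one
-- copy at one of them). Although the sites behave differently for the three
-- classes, the numbers of active sites of the words obtained from a word with m
-- active sites form in each case the same multiset, depending only on m and the
-- multiplicity. Hence the three generating trees coincide.
module Submission where

open import Defs
open import Data.Bool using (true; false; if_then_else_)
open import Data.Fin as Fin using (Fin; zero; suc; toℕ)
open import Data.List using (List; []; _∷_; _++_; map; length; lookup; filter; tabulate; concatMap; replicate)
open import Data.List.Extrema.Nat using (max; xs≤max; v≤max⁺)
open import Data.List.Membership.Propositional using (_∈_; find; lose)
open import Data.List.Membership.Propositional.Properties using (∈-++⁺ˡ; ∈-++⁺ʳ; ∈-++⁻; ∈-map⁺; ∈-map⁻; ∈-concatMap⁺; ∈-concatMap⁻; ∈-filter⁺; ∈-filter⁻; ∈-upTo⁺; ∈-cartesianProductWith⁺; ∈-lookup)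
open import Data.List.Membership.Propositional.Properties.WithK using (unique∧set⇒bag)
open import Data.List.Properties using (filter-accept; filter-reject; filter-all; filter-none; ∷-injective; ∷-injectiveˡ; ∷-injectiveʳ; map-++; map-∘; tabulate-cong; length-replicate)
open import Data.List.Relation.Binary.BagAndSetEquality using (∼bag⇒↭)
open import Data.List.Relation.Binary.Permutation.Propositional using (_↭_)
open import Data.List.Relation.Binary.Permutation.Propositional.Properties using (↭-length; filter-↭)
open import Data.List.Relation.Binary.Sublist.Propositional using (_⊆_; []; _∷_; _∷ʳ_; minimum; ⊆-refl; ⊆-trans; from∈)
open import Data.List.Relation.Binary.Sublist.Propositional.Properties using (All-resp-⊆)
open import Data.List.Relation.Unary.All as All using (All; []; _∷_)
open import Data.List.Relation.Unary.All.Properties using (replicate⁺)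
open import Data.List.Relation.Unary.AllPairs as AllPairs using (AllPairs; []; _∷_; allPairs?)
open import Data.List.Relation.Unary.Any using (here)
open import Data.List.Relation.Unary.Unique.Propositional using (Unique)
import Data.List.Relation.Unary.Unique.Propositional.Properties as Unique
open import Data.Nat using (ℕ; zero; suc; pred; _+_; _⊓_; _≤_; _<_; _≥_; _≤?_; _<?_; _≥?_; _≟_; z≤n; s≤s; s≤s⁻¹; z<s; s<s; s<s⁻¹)
open import Data.Nat.ListAction using (sum)
open import Data.Nat.ListAction.Properties using (sum-++)
open import Data.Nat.Properties
open import Data.Nat.Tactic.RingSolver using (solve-∀)
open import Data.Product using (_×_; _,_; proj₁; proj₂; ∃-syntax; map₂)
open import Data.Sum using (inj₁; inj₂)
open import Function using (_∘_; const; _⇔_; mk⇔; Equivalence)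
open import Relation.Binary.Definitions using (tri<; tri≈; tri>)
open import Relation.Binary.PropositionalEquality
open import Relation.Nullary using (¬_; Dec; yes; no; does; ¬?; _×-dec_; contradiction)
open import Relation.Nullary.Decidable using (map′; dec-true; dec-false; from-yes)

-- The tree is handled by duality. Labels are never listed: an arbitrary test function `f` is summed
-- over the labels of all children, so that inserting a block of equal letters becomes the operator
-- `children a` on test functions. Having the identity for every `f` is what permits iteration, and
-- `f = const 1` finally counts. Each sum is evaluated by reading the parent from left to right and
-- asking whether the front site receives a copy, which splits the same operator in three ways. For
-- 132 a front copy accounts for exactly the last summand of `children`. For 123 the largest label
-- comes from the word with all copies at the end, so the summands have to be regrouped. For 213 the
-- activity of a site depends on the letters before it: the recursion carries their minimum, and an
-- active site passed without a copy raises every later label by one, turning `f` into `f ∘ suc`.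

choose : {A : Set} → Dec A → ℕ → ℕ → ℕ
choose d m n = if does d then m else n

module _ {A : Set} (d : Dec A) {m n : ℕ} where

  choose-yes : A → choose d m n ≡ m
  choose-yes a rewrite dec-true d a = refl

  choose-no : ¬ A → choose d m n ≡ n
  choose-no ¬a rewrite dec-false d ¬a = refl

-- Deciders are compared only through their propositions, so no search for patterns is ever
-- unfolded.
choose-cong : {A B : Set} (d : Dec A) (e : Dec B) {m n m′ n′ : ℕ} →
              (A → B) → (B → A) → (B → m ≡ m′) → (¬ B → n ≡ n′) →
              choose d m n ≡ choose e m′ n′
choose-cong d (yes b) f g m≡ n≡ = trans (choose-yes d (g b)) (m≡ b)
choose-cong d (no ¬b) f g m≡ n≡ = trans (choose-no d (¬b ∘ f)) (n≡ ¬b)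

-- Sums over lists of words

total : (Word → ℕ) → List Word → ℕ
total F σs = sum (map F σs)

total-++ : ∀ F σs τs → total F (σs ++ τs) ≡ total F σs + total F τs
total-++ F σs τs = trans (cong sum (map-++ F σs τs)) (sum-++ (map F σs) (map F τs))

total-map : ∀ F (g : Word → Word) σs → total F (map g σs) ≡ total (F ∘ g) σs
total-map F g σs = cong sum (sym (map-∘ σs))

total-cong : ∀ {F G : Word → ℕ} {σs} → All (λ σ → F σ ≡ G σ) σs → total F σs ≡ total G σs
total-cong []         = refl
total-cong (eq ∷ eqs) = cong₂ _+_ eq (total-cong eqs)

total-concatMap : ∀ F (g : Word → List Word) σs → total F (concatMap g σs) ≡ total (total F ∘ g) σs
total-concatMap F g []       = refl
total-concatMap F g (σ ∷ σs) =
  trans (total-++ F (g σ) (concatMap g σs)) (cong (total F (g σ) +_) (total-concatMap F g σs))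

length-filter-total : {P : Word → Set} (P? : ∀ σ → Dec (P σ)) (σs : List Word) →
                      length (filter P? σs) ≡ total (λ σ → choose (P? σ) 1 0) σs
length-filter-total P? []       = refl
length-filter-total P? (σ ∷ σs) with P? σ
... | yes _ = cong suc (length-filter-total P? σs)
... | no _  = length-filter-total P? σs

-- The map `g` sends each child back to its parent, so distinct parents have disjoint lists of
-- children.
concatMap-unique : ∀ {f : Word → List Word} (g : Word → Word) {xs} →
                   All (λ x → Unique (f x) × (∀ {y} → y ∈ f x → g y ≡ x)) xs →
                   Unique xs → Unique (concatMap f xs)
concatMap-unique g [] [] = []
concatMap-unique {f} g {x ∷ xs} ((uniq , g≡) ∷ ps) (x∉ ∷ xs!) =
  Unique.++⁺ uniq (concatMap-unique g ps xs!) disjoint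
  where
  disjoint : ∀ {y} → ¬ (y ∈ f x × y ∈ concatMap f xs)
  disjoint (y∈ , y∈′) with find (∈-concatMap⁻ f {xs = xs} y∈′)
  ... | x′ , x′∈ , y∈″ =
    All.lookup x∉ x′∈ (trans (sym (g≡ y∈)) (proj₂ (All.lookup ps x′∈) y∈″))

-- Shuffles of a word with copies of one letter

-- Ins j a π σ: the word σ is a shuffle of π with a copies of j. Letters are
-- kept one by one only while copies remain, so derivations are unique.
data Ins (j : ℕ) : ℕ → Word → Word → Set where
  stop : ∀ {π} → Ins j 0 π π
  put  : ∀ {a π σ} → Ins j a π σ → Ins j (suc a) π (j ∷ σ)
  keep : ∀ {a x π σ} → Ins j (suc a) π σ → Ins j (suc a) (x ∷ π) (x ∷ σ)

insertions : ℕ → ℕ → Word → List Word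
insertions j zero    π       = π ∷ []
insertions j (suc a) []      = map (j ∷_) (insertions j a [])
insertions j (suc a) (x ∷ π) =
  map (j ∷_) (insertions j a (x ∷ π)) ++ map (x ∷_) (insertions j (suc a) π)

-- Letters already passed are absorbed into `F`, so a count over shuffles is an induction along the
-- word in which only the summand is rewritten.
insertSum : ℕ → ℕ → Word → (Word → ℕ) → ℕ
insertSum j zero    π       F = F π
insertSum j (suc a) []      F = insertSum j a [] (F ∘ (j ∷_))
insertSum j (suc a) (x ∷ π) F =
  insertSum j a (x ∷ π) (F ∘ (j ∷_)) + insertSum j (suc a) π (F ∘ (x ∷_))

module _ {j : ℕ} where

  total-insertions : ∀ a π F → total F (insertions j a π) ≡ insertSum j a π F
  total-insertions zero    π       F = +-identityʳ (F π)
  total-insertions (suc a) []      F =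
    trans (total-map F (j ∷_) (insertions j a [])) (total-insertions a [] _)
  total-insertions (suc a) (x ∷ π) F =
    trans (total-++ F (map (j ∷_) (insertions j a (x ∷ π))) _)
      (cong₂ _+_
        (trans (total-map F (j ∷_) (insertions j a (x ∷ π))) (total-insertions a (x ∷ π) _))
        (trans (total-map F (x ∷_) (insertions j (suc a) π)) (total-insertions (suc a) π _)))

  insertSum-cong : ∀ {a π F G} → (∀ {σ} → Ins j a π σ → F σ ≡ G σ) →
                   insertSum j a π F ≡ insertSum j a π G
  insertSum-cong {zero}          F≡G = F≡G stop
  insertSum-cong {suc a} {[]}    F≡G = insertSum-cong {a} {[]} (F≡G ∘ put)
  insertSum-cong {suc a} {x ∷ π} F≡G =
    cong₂ _+_ (insertSum-cong {a} (F≡G ∘ put)) (insertSum-cong {suc a} {π} (F≡G ∘ keep))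

  insertSum-zero : ∀ {a π F} → (∀ {σ} → Ins j a π σ → F σ ≡ 0) → insertSum j a π F ≡ 0
  insertSum-zero {a} {π} F≡0 = trans (insertSum-cong {a} {π} F≡0) (const-zero a π)
    where
    const-zero : ∀ a π → insertSum j a π (const 0) ≡ 0
    const-zero zero    π       = refl
    const-zero (suc a) []      = const-zero a []
    const-zero (suc a) (x ∷ π) = cong₂ _+_ (const-zero a (x ∷ π)) (const-zero (suc a) π)

  insertSum-[] : ∀ a {F} → insertSum j a [] F ≡ F (replicate a j)
  insertSum-[] zero    = refl
  insertSum-[] (suc a) = insertSum-[] a

  ∈-insertions⁺ : ∀ {a π σ} → Ins j a π σ → σ ∈ insertions j a π
  ∈-insertions⁺ stop                 = here refl
  ∈-insertions⁺ {π = []}    (put i)  = ∈-map⁺ (j ∷_) (∈-insertions⁺ i)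
  ∈-insertions⁺ {π = x ∷ π} (put i)  = ∈-++⁺ˡ (∈-map⁺ (j ∷_) (∈-insertions⁺ i))
  ∈-insertions⁺ {suc a} {x ∷ π} (keep i) =
    ∈-++⁺ʳ (map (j ∷_) (insertions j a (x ∷ π))) (∈-map⁺ (x ∷_) (∈-insertions⁺ i))

  ∈-insertions⁻ : ∀ a π {σ} → σ ∈ insertions j a π → Ins j a π σ
  ∈-insertions⁻ zero    π  (here refl) = stop
  ∈-insertions⁻ (suc a) [] σ∈ with ∈-map⁻ (j ∷_) σ∈
  ... | _ , τ∈ , refl = put (∈-insertions⁻ a [] τ∈)
  ∈-insertions⁻ (suc a) (x ∷ π) σ∈ with ∈-++⁻ (map (j ∷_) (insertions j a (x ∷ π))) σ∈
  ... | inj₁ σ∈ˡ with ∈-map⁻ (j ∷_) σ∈ˡ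
  ...   | _ , τ∈ , refl = put (∈-insertions⁻ a (x ∷ π) τ∈)
  ∈-insertions⁻ (suc a) (x ∷ π) σ∈ | inj₂ σ∈ʳ with ∈-map⁻ (x ∷_) σ∈ʳ
  ...   | _ , τ∈ , refl = keep (∈-insertions⁻ (suc a) π τ∈)

  insertions-unique : ∀ a {π} → All (j <_) π → Unique (insertions j a π)
  insertions-unique zero    _  = [] ∷ []
  insertions-unique (suc a) [] = Unique.map⁺ ∷-injectiveʳ (insertions-unique a [])
  insertions-unique (suc a) {x ∷ π} j<@(j<x ∷ j<π) =
    Unique.++⁺ (Unique.map⁺ ∷-injectiveʳ (insertions-unique a j<))
               (Unique.map⁺ ∷-injectiveʳ (insertions-unique (suc a) j<π)) disjoint
    where
    disjoint : ∀ {σ} → ¬ (σ ∈ map (j ∷_) (insertions j a (x ∷ π)) ×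
                          σ ∈ map (x ∷_) (insertions j (suc a) π))
    disjoint (p , q) with ∈-map⁻ (j ∷_) p | ∈-map⁻ (x ∷_) q
    ... | _ , _ , refl | _ , _ , eq = <⇒≢ j<x (∷-injectiveˡ eq)

  Ins-length : ∀ {a π σ} → Ins j a π σ → length σ ≡ a + length π
  Ins-length stop                   = refl
  Ins-length (put i)                = cong suc (Ins-length i)
  Ins-length {suc a} {x ∷ π} (keep i) =
    trans (cong suc (Ins-length i)) (sym (+-suc (suc a) (length π)))

  Ins-all : ∀ {P : ℕ → Set} {a π σ} → P j → All P π → Ins j a π σ → All P σ
  Ins-all pj pπ       stop     = pπ
  Ins-all pj pπ       (put i)  = pj ∷ Ins-all pj pπ i
  Ins-all pj (p ∷ pπ) (keep i) = p ∷ Ins-all pj pπ i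

  -- When no copies remain, the kept letter has to be absorbed by `stop`, since `keep` demands a
  -- remaining copy.
  keep-any : ∀ {a x π σ} → Ins j a π σ → Ins j a (x ∷ π) (x ∷ σ)
  keep-any stop       = stop
  keep-any i@(put _)  = keep i
  keep-any i@(keep _) = keep i

  Ins-filter : ∀ {a π σ} → All (j <_) π → Ins j a π σ → filter (j <?_) σ ≡ π
  Ins-filter j<π         stop     = filter-all (j <?_) j<π
  Ins-filter j<π         (put i)  = trans (filter-reject (j <?_) (n≮n j)) (Ins-filter j<π i)
  Ins-filter (j<x ∷ j<π) (keep i) =
    trans (filter-accept (j <?_) j<x) (cong (_ ∷_) (Ins-filter j<π i))

  occurrences-here : ∀ σ → occurrences j (j ∷ σ) ≡ suc (occurrences j σ)
  occurrences-here σ = cong length (filter-accept (j ≟_) refl)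

  occurrences-there : ∀ {i} σ → i ≢ j → occurrences i (j ∷ σ) ≡ occurrences i σ
  occurrences-there {i} σ i≢j = cong length (filter-reject (i ≟_) i≢j)

occurrences-cong : ∀ i x {σ τ} → occurrences i σ ≡ occurrences i τ →
                   occurrences i (x ∷ σ) ≡ occurrences i (x ∷ τ)
occurrences-cong i x eq with does (i ≟ x)
... | true  = cong suc eq
... | false = eq

module _ {j : ℕ} where

  Ins-occurrences-≡ : ∀ {a π σ} → All (j <_) π → Ins j a π σ → occurrences j σ ≡ a
  Ins-occurrences-≡ j<π stop = cong length (filter-none (j ≟_) (All.map <⇒≢ j<π))
  Ins-occurrences-≡ j<π (put {σ = σ} i) =
    trans (occurrences-here σ) (cong suc (Ins-occurrences-≡ j<π i))
  Ins-occurrences-≡ (j<x ∷ j<π) (keep {σ = σ} i) =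
    trans (occurrences-there σ (<⇒≢ j<x)) (Ins-occurrences-≡ j<π i)

  Ins-occurrences-≢ : ∀ {i a π σ} → i ≢ j → Ins j a π σ → occurrences i σ ≡ occurrences i π
  Ins-occurrences-≢ i≢j stop    = refl
  Ins-occurrences-≢ i≢j (put {σ = σ} ins) =
    trans (occurrences-there σ i≢j) (Ins-occurrences-≢ i≢j ins)
  Ins-occurrences-≢ {i} i≢j (keep {x = x} ins) = occurrences-cong i x (Ins-occurrences-≢ i≢j ins)

  Ins-complete : ∀ {σ} → All (j ≤_) σ → Ins j (occurrences j σ) (filter (j <?_) σ) σ
  Ins-complete [] = stop
  Ins-complete {x ∷ σ} (j≤x ∷ j≤σ) with m≤n⇒m<n∨m≡n j≤x
  ... | inj₁ j<x
    rewrite filter-accept (j <?_) {xs = σ} j<x | occurrences-there {x} σ (<⇒≢ j<x) =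
    keep-any (Ins-complete j≤σ)
  ... | inj₂ refl
    rewrite filter-reject (j <?_) {xs = σ} (n≮n j) | occurrences-here {j} σ =
    put (Ins-complete j≤σ)

-- Multipermutations by successive insertion

-- All words with mult i occurrences of the letter b + i for each i, built by
-- inserting the letters from the largest to the smallest.
generate : ∀ {k} → ℕ → (Fin k → ℕ) → List Word
generate {zero}  b mult = [] ∷ []
generate {suc k} b mult = concatMap (insertions b (mult zero)) (generate (suc b) (mult ∘ suc))

HasContent : ∀ {k} → ℕ → (Fin k → ℕ) → Word → Set
HasContent {k} b mult σ =
  (∀ i → occurrences (b + toℕ i) σ ≡ mult i) × All (λ x → b ≤ x × x < b + k) σ

∈-generate⁻ : ∀ {k} b (mult : Fin k → ℕ) {σ} → σ ∈ generate b mult →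
              HasContent b mult σ × length σ ≡ sum (tabulate mult)
∈-generate⁻ {zero}  b mult (here refl) = ((λ ()) , []) , refl
∈-generate⁻ {suc k} b mult {σ} σ∈
  with find (∈-concatMap⁻ (insertions b (mult zero)) {xs = generate (suc b) (mult ∘ suc)} σ∈)
... | π , π∈ , σ∈π with ∈-generate⁻ (suc b) (mult ∘ suc) π∈ | ∈-insertions⁻ (mult zero) π σ∈π
... | (occ , bounds) , len | ins = (occ′ , bounds′) , trans (Ins-length ins) (cong (mult zero +_) len)
  where
  occ′ : ∀ i → occurrences (b + toℕ i) σ ≡ mult i
  occ′ zero rewrite +-identityʳ b = Ins-occurrences-≡ (All.map proj₁ bounds) ins
  occ′ (suc i) rewrite +-suc b (toℕ i) =
    trans (Ins-occurrences-≢ (≢-sym (<⇒≢ (s≤s (m≤m+n b (toℕ i))))) ins) (occ i)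

  bounds′ : All (λ x → b ≤ x × x < b + suc k) σ
  bounds′ = Ins-all (≤-refl , m<m+n b (s≤s z≤n))
    (All.map (λ {x} (lo , hi) → <⇒≤ lo , subst (x <_) (sym (+-suc b k)) hi) bounds) ins

∈-generate⁺ : ∀ {k} b (mult : Fin k → ℕ) {σ} → HasContent b mult σ → σ ∈ generate b mult
∈-generate⁺ {zero}  b mult {[]}    _ = here refl
∈-generate⁺ {zero}  b mult {x ∷ σ} (_ , (lo , hi) ∷ _) rewrite +-identityʳ b =
  contradiction hi (≤⇒≯ lo)
∈-generate⁺ {suc k} b mult {σ} (occ , bounds) =
  ∈-concatMap⁺ (insertions b (mult zero)) (lose π∈ (∈-insertions⁺ ins))
  where
  π : Word
  π = filter (b <?_) σ

  ins : Ins b (mult zero) π σ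
  ins = subst (λ a → Ins b a π σ)
          (trans (cong (λ i → occurrences i σ) (sym (+-identityʳ b))) (occ zero))
          (Ins-complete (All.map proj₁ bounds))

  occπ : ∀ i → occurrences (suc b + toℕ i) π ≡ mult (suc i)
  occπ i = trans (sym (Ins-occurrences-≢ (≢-sym (<⇒≢ (s≤s (m≤m+n b (toℕ i))))) ins))
             (trans (cong (λ j → occurrences j σ) (sym (+-suc b (toℕ i)))) (occ (suc i)))

  boundsπ : All (λ x → suc b ≤ x × x < suc b + k) π
  boundsπ = All.tabulate λ {x} x∈ → let x∈σ , b<x = ∈-filter⁻ (b <?_) x∈ in
    b<x , subst (x <_) (+-suc b k) (proj₂ (All.lookup bounds x∈σ))

  π∈ : π ∈ generate (suc b) (mult ∘ suc)
  π∈ = ∈-generate⁺ (suc b) (mult ∘ suc) (occπ , boundsπ)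

generate-letters : ∀ {k} b (mult : Fin k → ℕ) → All (All (b ≤_)) (generate b mult)
generate-letters b mult =
  All.tabulate (λ σ∈ → All.map proj₁ (proj₂ (proj₁ (∈-generate⁻ b mult σ∈))))

generate-unique : ∀ {k} b (mult : Fin k → ℕ) → Unique (generate b mult)
generate-unique {zero}  b mult = [] ∷ []
generate-unique {suc k} b mult =
  concatMap-unique (filter (b <?_))
    (All.map (λ b<π → insertions-unique (mult zero) b<π ,
                      λ {_} σ∈ → Ins-filter b<π (∈-insertions⁻ (mult zero) _ σ∈))
             (generate-letters (suc b) (mult ∘ suc)))
    (generate-unique (suc b) (mult ∘ suc))

words-unique : ∀ k n → Unique (words k n)
words-unique k zero    = [] ∷ []
words-unique k (suc n) =
  Unique.cartesianProductWith⁺ _∷_ ∷-injective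
    (Unique.map⁺ suc-injective (Unique.upTo⁺ k)) (words-unique k n)

∈-words : ∀ {k σ} → All (λ x → 1 ≤ x × x ≤ k) σ → σ ∈ words k (length σ)
∈-words [] = here refl
∈-words {σ = suc x ∷ σ} ((_ , x<k) ∷ p) =
  ∈-cartesianProductWith⁺ _∷_ (∈-map⁺ suc (∈-upTo⁺ x<k)) (∈-words p)

-- Both lists are free of duplicates and have the same members.
multipermutations-↭ : ∀ S → multipermutations S ↭ generate 1 (Multiset.mult S)
multipermutations-↭ S =
  ∼bag⇒↭ (unique∧set⇒bag (Unique.filter⁺ (isMultipermutation? S) (words-unique k n))
                          (generate-unique 1 mult) (mk⇔ to from))
  where
  open Multiset S

  n : ℕ
  n = sum (tabulate mult)

  to : ∀ {σ} → σ ∈ multipermutations S → σ ∈ generate 1 mult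
  to σ∈ = let occ , bounds = proj₂ (∈-filter⁻ (isMultipermutation? S) {xs = words k n} σ∈) in
    ∈-generate⁺ 1 mult (occ , All.map (map₂ s≤s) bounds)

  from : ∀ {σ} → σ ∈ generate 1 mult → σ ∈ multipermutations S
  from {σ} σ∈ = let (occ , bounds) , len = ∈-generate⁻ 1 mult σ∈
                    bounds′ = All.map (map₂ s≤s⁻¹) bounds in
    ∈-filter⁺ (isMultipermutation? S) (subst (λ n → σ ∈ words k n) len (∈-words bounds′))
      (occ , bounds′)

-- The succession rule and the count it determines

sumFrom2 : (ℕ → ℕ) → ℕ → ℕ
sumFrom2 f zero    = 0
sumFrom2 f (suc m) = sumFrom2 f m + f (suc (suc m))

extra : ℕ → (ℕ → ℕ) → ℕ → ℕ
extra zero    f m = 0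
extra (suc a) f m = sumFrom2 f m

-- The sum of f over the numbers of active sites of the words obtained by
-- inserting suc a copies of a new smallest letter into a word with m active
-- sites. These numbers are a + 2, …, a + m + 1, each once, and for suc a ≥ 2 also
-- q + 1 with multiplicity m - q for each 1 ≤ q < m.
children : ℕ → (ℕ → ℕ) → ℕ → ℕ
children a f zero    = 0
children a f (suc m) = children a f m + (f (suc (suc (a + m))) + extra a f m)

children-1 : ∀ a f → children a f 1 ≡ f (suc (suc (a + 0)))
children-1 zero    f = +-identityʳ _
children-1 (suc a) f = +-identityʳ _

record GeneratingTree (P : List Word) : Set where
  field
    weight        : (ℕ → ℕ) → Word → ℕ
    weight-const  : ∀ σ → choose (avoidsAll? P σ) 1 0 ≡ weight (const 1) σ
    weight-[]     : ∀ f → weight f [] ≡ f 1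
    weight-insert : ∀ j a f {π} → All (j <_) π →
                    insertSum j (suc a) π (weight f) ≡ weight (children a f) π

-- The smallest letter is inserted last, so its operator is the first to act on `f`. The `pred` is
-- there because `children a` describes `suc a` copies, and the base value is `f 1` because the
-- empty word has one active site.
leaves : ∀ {k} → (Fin k → ℕ) → (ℕ → ℕ) → ℕ
leaves {zero}  mult f = f 1
leaves {suc k} mult f = leaves (mult ∘ suc) (children (pred (mult zero)) f)

module _ {P : List Word} (T : GeneratingTree P) where
  open GeneratingTree T

  total-generate : ∀ {k} b (mult : Fin k → ℕ) f → (∀ i → 1 ≤ mult i) →
                   total (weight f) (generate b mult) ≡ leaves mult f
  total-generate {zero}  b mult f mult≥1 = trans (+-identityʳ _) (weight-[] f)
  total-generate {suc k} b mult f mult≥1 =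
    trans (total-concatMap (weight f) (insertions b (mult zero)) (generate (suc b) (mult ∘ suc)))
      (trans (total-cong (All.map step (generate-letters (suc b) (mult ∘ suc))))
        (total-generate (suc b) (mult ∘ suc) _ (mult≥1 ∘ suc)))
    where
    step : ∀ {π} → All (b <_) π → total (weight f) (insertions b (mult zero) π) ≡
                                  weight (children (pred (mult zero)) f) π
    step {π} b<π with mult zero | mult≥1 zero
    ... | suc a | _ = trans (total-insertions (suc a) π (weight f)) (weight-insert b a f b<π)

  av-leaves : ∀ S → av S P ≡ leaves (Multiset.mult S) (const 1)
  av-leaves S =
    trans (↭-length (filter-↭ (avoidsAll? P) (multipermutations-↭ S)))
      (trans (length-filter-total (avoidsAll? P) (generate 1 mult))
        (trans (total-cong (All.universal weight-const (generate 1 mult)))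
          (total-generate 1 mult (const 1) mult≥1)))
    where open Multiset S

tree⇒∼ : ∀ {P Q} → GeneratingTree P → GeneratingTree Q → P ∼ Q
tree⇒∼ T U S = trans (av-leaves T S) (sym (av-leaves U S))

-- Pattern occurrences as sublists

lower : ∀ {ℓ n} (i : Fin ℓ → Fin (suc n)) → StrictlyIncreasing i → (∀ a → 0 < toℕ (i a)) →
        ∃[ i⁻ ] (StrictlyIncreasing i⁻ × (∀ a → suc (i⁻ a) ≡ i a))
lower {ℓ} {n} i inc i>0 = i⁻ , inc⁻ , suc-i⁻
  where
  predecessor : (p : Fin (suc n)) → 0 < toℕ p → ∃[ q ] suc q ≡ p
  predecessor (suc q) _ = q , refl
  i⁻ : Fin ℓ → Fin n
  i⁻ a = proj₁ (predecessor (i a) (i>0 a))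
  suc-i⁻ : ∀ a → suc (i⁻ a) ≡ i a
  suc-i⁻ a = proj₂ (predecessor (i a) (i>0 a))
  inc⁻ : StrictlyIncreasing i⁻
  inc⁻ a b a<b = s<s⁻¹ (subst₂ Fin._<_ (sym (suc-i⁻ a)) (sym (suc-i⁻ b)) (inc a b a<b))

-- Either the first index is position 0 and `x` is taken, or all indices are positive and `x` is
-- skipped; `lower` then shifts the remaining indices down.
embedding⇒⊆ : ∀ {ℓ} (π : Word) (i : Fin ℓ → Fin (length π)) → StrictlyIncreasing i →
              tabulate (lookup π ∘ i) ⊆ π
embedding⇒⊆ {zero}  π       i inc = minimum π
embedding⇒⊆ {suc ℓ} []      i inc with () ← i zero
embedding⇒⊆ {suc ℓ} (x ∷ π) i inc with i zero in i0
... | zero with lower (i ∘ suc) (λ a b a<b → inc (suc a) (suc b) (s<s a<b))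
                      (λ a → subst (Fin._< i (suc a)) i0 (inc zero (suc a) z<s))
...   | i⁻ , inc⁻ , suc-i⁻ =
  refl ∷ subst (_⊆ π) (tabulate-cong (cong (lookup (x ∷ π)) ∘ suc-i⁻)) (embedding⇒⊆ π i⁻ inc⁻)
embedding⇒⊆ {suc ℓ} (x ∷ π) i inc | suc c with lower i inc i>0
  where
  i>0 : ∀ a → 0 < toℕ (i a)
  i>0 zero    = subst (λ p → 0 < toℕ p) (sym i0) z<s
  i>0 (suc a) = ≤-<-trans z≤n (inc zero (suc a) z<s)
...   | i⁻ , inc⁻ , suc-i⁻ =
  x ∷ʳ subst (_⊆ π) (trans (tabulate-cong (cong (lookup (x ∷ π)) ∘ suc-i⁻))
                           (cong (λ p → lookup (x ∷ π) p ∷ tabulate (lookup (x ∷ π) ∘ i ∘ suc)) i0))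
         (embedding⇒⊆ π i⁻ inc⁻)

⊆⇒embedding : ∀ (φ : ℕ → ℕ) ρ {π} → map φ ρ ⊆ π →
              ∃[ i ] (StrictlyIncreasing i × (∀ a → lookup π (i a) ≡ φ (lookup ρ a)))
⊆⇒embedding φ []      _         = (λ ()) , (λ ()) , (λ ())
⊆⇒embedding φ (r ∷ ρ) (x ∷ʳ s) with ⊆⇒embedding φ (r ∷ ρ) s
... | i , inc , val = suc ∘ i , (λ a b a<b → s<s (inc a b a<b)) , val
⊆⇒embedding φ (r ∷ ρ) {x ∷ π} (r≡x ∷ s) with ⊆⇒embedding φ ρ s
... | i , inc , val = i⁺ , inc⁺ , val⁺
  where
  i⁺ : Fin (suc (length ρ)) → Fin (suc (length π))
  i⁺ zero    = zero
  i⁺ (suc a) = suc (i a)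
  inc⁺ : StrictlyIncreasing i⁺
  inc⁺ zero    (suc b) _         = z<s
  inc⁺ (suc a) (suc b) (s≤s a<b) = s<s (inc a b a<b)
  val⁺ : ∀ a → lookup (x ∷ π) (i⁺ a) ≡ φ (lookup (r ∷ ρ) a)
  val⁺ zero    = sym r≡x
  val⁺ (suc a) = val a

-- A map that is strictly monotone on positive letters also reflects their order, by trichotomy.
-- This yields both directions of every comparison at once.
⊆⇒Contains : ∀ (φ : ℕ → ℕ) → (∀ {u v} → 1 ≤ u → u < v → φ u < φ v) →
             ∀ {ρ π} → All (1 ≤_) ρ → map φ ρ ⊆ π → Contains π ρ
⊆⇒Contains φ mono {ρ} {π} ρ≥1 s with ⊆⇒embedding φ ρ s
... | i , inc , val = i , inc , λ a b → iff a b , iff b a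
  where
  reflects : ∀ {u v} → 1 ≤ v → φ u < φ v → u < v
  reflects {u} {v} v≥1 φu<φv with <-cmp u v
  ... | tri< u<v _ _ = u<v
  ... | tri≈ _ refl _ = contradiction φu<φv (n≮n _)
  ... | tri> _ _ v<u = contradiction φu<φv (<-asym (mono v≥1 v<u))

  iff : ∀ a b → lookup π (i a) < lookup π (i b) ⇔ lookup ρ a < lookup ρ b
  iff a b rewrite val a | val b =
    mk⇔ (reflects (All.lookup ρ≥1 (∈-lookup b))) (mono (All.lookup ρ≥1 (∈-lookup a)))

-- The value at 0 is junk, as patterns have no letter 0.
place : ℕ → ℕ → ℕ → ℕ → ℕ
place x y z 0                   = 0
place x y z 1                   = x
place x y z 2                   = y
place x y z (suc (suc (suc n))) = z + n

place-mono : ∀ {x y z} → x < y → y < z → ∀ {u v} → 1 ≤ u → u < v → place x y z u < place x y z v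
place-mono x<y y<z {1} {2} _ _ = x<y
place-mono {z = z} x<y y<z {1} {suc (suc (suc n))} _ _ = <-≤-trans (<-trans x<y y<z) (m≤m+n z n)
place-mono {z = z} x<y y<z {2} {suc (suc (suc n))} _ _ = <-≤-trans y<z (m≤m+n z n)
place-mono {z = z} x<y y<z {suc (suc (suc m))} {suc (suc (suc n))} _ (s≤s (s≤s (s≤s m<n))) = +-monoʳ-< z m<n
place-mono _ _ {1} {1} _ (s≤s ())
place-mono _ _ {2} {1} _ (s≤s ())
place-mono _ _ {2} {2} _ (s≤s (s≤s ()))
place-mono _ _ {suc (suc (suc m))} {1} _ (s≤s ())
place-mono _ _ {suc (suc (suc m))} {2} _ (s≤s (s≤s ()))

p123 p132 p213 p1121 p1211 : Word
p123  = 1 ∷ 2 ∷ 3 ∷ []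
p132  = 1 ∷ 3 ∷ 2 ∷ []
p213  = 2 ∷ 1 ∷ 3 ∷ []
p1121 = 1 ∷ 1 ∷ 2 ∷ 1 ∷ []
p1211 = 1 ∷ 2 ∷ 1 ∷ 1 ∷ []

No123 No132 No213 No1121 No1211 : Word → Set
No123  σ = ∀ {x y z} → x < y → y < z → ¬ (x ∷ y ∷ z ∷ [] ⊆ σ)
No132  σ = ∀ {x y z} → x < y → y < z → ¬ (x ∷ z ∷ y ∷ [] ⊆ σ)
No213  σ = ∀ {x y z} → x < y → y < z → ¬ (y ∷ x ∷ z ∷ [] ⊆ σ)
No1121 σ = ∀ {x y} → x < y → ¬ (x ∷ x ∷ y ∷ x ∷ [] ⊆ σ)
No1211 σ = ∀ {x y} → x < y → ¬ (x ∷ y ∷ x ∷ x ∷ [] ⊆ σ)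

module _ (π : Word) where

  private
    all≥1? : ∀ ρ → Dec (All (1 ≤_) ρ)
    all≥1? = All.all? (1 ≤?_)

    1<2 : 1 < 2
    1<2 = s≤s (s≤s z≤n)
    2<3 : 2 < 3
    2<3 = s≤s (s≤s (s≤s z≤n))

  module Occurrence (ρ : Word) (c : Contains π ρ) where
    val : Fin (length ρ) → ℕ
    val = lookup π ∘ proj₁ c
    sub : tabulate val ⊆ π
    sub = embedding⇒⊆ π (proj₁ c) (proj₁ (proj₂ c))
    same : SameOrderAt π ρ (proj₁ c)
    same = proj₂ (proj₂ c)
    lt : ∀ a b → lookup ρ a < lookup ρ b → val a < val b
    lt a b = Equivalence.from (proj₁ (same a b))
    eq : ∀ a b → lookup ρ a ≡ lookup ρ b → val a ≡ val b
    eq a b ρ≡ with <-cmp (val a) (val b)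
    ... | tri< l _ _ = contradiction (Equivalence.to (proj₁ (same a b)) l) (<-irrefl ρ≡)
    ... | tri≈ _ e _ = e
    ... | tri> _ _ g = contradiction (Equivalence.to (proj₂ (same a b)) g) (<-irrefl (sym ρ≡))

  avoids-123 : Avoids π p123 ⇔ No123 π
  avoids-123 = mk⇔
    (λ av {x} {y} {z} x<y y<z s → av (⊆⇒Contains (place x y z) (place-mono x<y y<z)
      -- The letter 3 is placed at `z + 0`, which does not compute to `z`.
      (from-yes (all≥1? p123)) (subst (λ c → x ∷ y ∷ c ∷ [] ⊆ π) (sym (+-identityʳ z)) s)))
    (λ no c → let open Occurrence p123 c in no (lt zero (suc zero) 1<2) (lt (suc zero) (suc (suc zero)) 2<3) sub)

  avoids-132 : Avoids π p132 ⇔ No132 π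
  avoids-132 = mk⇔
    (λ av {x} {y} {z} x<y y<z s → av (⊆⇒Contains (place x y z) (place-mono x<y y<z)
      (from-yes (all≥1? p132)) (subst (λ c → x ∷ c ∷ y ∷ [] ⊆ π) (sym (+-identityʳ z)) s)))
    (λ no c → let open Occurrence p132 c in no (lt zero (suc (suc zero)) 1<2) (lt (suc (suc zero)) (suc zero) 2<3) sub)

  avoids-213 : Avoids π p213 ⇔ No213 π
  avoids-213 = mk⇔
    (λ av {x} {y} {z} x<y y<z s → av (⊆⇒Contains (place x y z) (place-mono x<y y<z)
      (from-yes (all≥1? p213)) (subst (λ c → y ∷ x ∷ c ∷ [] ⊆ π) (sym (+-identityʳ z)) s)))
    (λ no c → let open Occurrence p213 c in no (lt (suc zero) zero 1<2) (lt zero (suc (suc zero)) 2<3) sub)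

  avoids-1121 : Avoids π p1121 ⇔ No1121 π
  avoids-1121 = mk⇔
    -- The pattern has no letter 3; `suc y` merely continues the placement monotonically.
    (λ av {x} {y} x<y s → av (⊆⇒Contains (place x y (suc y)) (place-mono x<y ≤-refl)
      (from-yes (all≥1? p1121)) s))
    (λ no c → let open Occurrence p1121 c
                  e₁ = eq (suc zero) zero refl
                  e₃ = eq (suc (suc (suc zero))) zero refl in
      no (lt zero (suc (suc zero)) 1<2) (subst₂ (λ u v → val zero ∷ u ∷ val (suc (suc zero)) ∷ v ∷ [] ⊆ π) e₁ e₃ sub))

  avoids-1211 : Avoids π p1211 ⇔ No1211 π
  avoids-1211 = mk⇔
    (λ av {x} {y} x<y s → av (⊆⇒Contains (place x y (suc y)) (place-mono x<y ≤-refl)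
      (from-yes (all≥1? p1211)) s))
    (λ no c → let open Occurrence p1211 c
                  e₂ = eq (suc (suc zero)) zero refl
                  e₃ = eq (suc (suc (suc zero))) zero refl in
      no (lt zero (suc zero) 1<2) (subst₂ (λ u v → val zero ∷ val (suc zero) ∷ u ∷ v ∷ [] ⊆ π) e₂ e₃ sub))

-- Unfolding the search through all embeddings would make conversion checking
-- intractable.
abstract
  avoids? : ∀ {ρ} {N : Word → Set} → (∀ π → Avoids π ρ ⇔ N π) → ∀ π → Dec (N π)
  avoids? {ρ} e π = map′ (Equivalence.to (e π)) (Equivalence.from (e π)) (¬? (contains? π ρ))

avoidsAll-pair : ∀ {ρ τ} {M N : Word → Set} →
                 (∀ π → Avoids π ρ ⇔ M π) → (∀ π → Avoids π τ ⇔ N π) →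
                 ∀ π → AvoidsAll (ρ ∷ τ ∷ []) π ⇔ (M π × N π)
avoidsAll-pair e f π = mk⇔
  (λ { (p ∷ q ∷ []) → Equivalence.to (e π) p , Equivalence.to (f π) q })
  (λ { (m , n) → Equivalence.from (e π) m ∷ Equivalence.from (f π) n ∷ [] })

-- Sublists of shuffles with a new smallest letter

drop-≢ : ∀ {x y : ℕ} {τ σ} → x ≢ y → x ∷ τ ⊆ y ∷ σ → x ∷ τ ⊆ σ
drop-≢ x≢y (_ ∷ʳ s) = s
drop-≢ x≢y (eq ∷ s) = contradiction eq x≢y

tail-⊆ : ∀ {x y : ℕ} {τ σ} → x ∷ τ ⊆ y ∷ σ → τ ⊆ σ
tail-⊆ (_ ∷ʳ s) = ⊆-trans (_ ∷ʳ ⊆-refl) s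
tail-⊆ (_ ∷ s)  = s

sublists⇒AllPairs : {_R_ : ℕ → ℕ → Set} → ∀ {σ} → (∀ {x y} → x ∷ y ∷ [] ⊆ σ → x R y) → AllPairs _R_ σ
sublists⇒AllPairs {σ = []}    r = []
sublists⇒AllPairs {σ = x ∷ σ} r =
  All.tabulate (λ y∈ → r (refl ∷ from∈ y∈)) ∷ sublists⇒AllPairs (λ s → r (x ∷ʳ s))

AllPairs⇒sublists : {_R_ : ℕ → ℕ → Set} → ∀ {σ x y} → AllPairs _R_ σ → x ∷ y ∷ [] ⊆ σ → x R y
AllPairs⇒sublists (rs ∷ _)  (refl ∷ s) with r ∷ _ ← All-resp-⊆ s rs = r
AllPairs⇒sublists (_ ∷ rss) (_ ∷ʳ s)   = AllPairs⇒sublists rss s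

module _ {j : ℕ} where

  Ins-⊆ : ∀ {a π σ} → Ins j a π σ → π ⊆ σ
  Ins-⊆ stop             = ⊆-refl
  Ins-⊆ (put i)          = j ∷ʳ Ins-⊆ i
  Ins-⊆ (keep i)         = refl ∷ Ins-⊆ i

  -- A sublist of letters above `j` cannot use an inserted copy.
  restrict : ∀ {a π σ τ} → Ins j a π σ → All (j <_) τ → τ ⊆ σ → τ ⊆ π
  restrict stop     _         s          = s
  restrict (put i)  j<τ       (_ ∷ʳ s)   = restrict i j<τ s
  restrict (put i)  (j<j ∷ _) (refl ∷ s) = contradiction j<j (n≮n j)
  restrict (keep i) j<τ       (x ∷ʳ s)   = x ∷ʳ restrict i j<τ s
  restrict (keep i) (_ ∷ j<τ) (eq ∷ s)   = eq ∷ restrict i j<τ s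

  copy-⊆ : ∀ {a π σ} → Ins j (suc a) π σ → j ∷ [] ⊆ σ
  copy-⊆ (put i)          = refl ∷ minimum _
  copy-⊆ (keep {x = x} i) = x ∷ʳ copy-⊆ i

  absent : ∀ {σ τ} → All (j <_) σ → ¬ (j ∷ τ ⊆ σ)
  absent j<σ s with j<j ∷ _ ← All-resp-⊆ s j<σ = n≮n j j<j

  -- Only two equal letters of the pattern precede its larger letter, so a third copy in the initial
  -- run creates nothing new.
  no1121-repeat : ∀ {σ} → No1121 (j ∷ j ∷ σ) → No1121 (j ∷ j ∷ j ∷ σ)
  no1121-repeat av x<y (_ ∷ʳ s)                    = av x<y s
  no1121-repeat av x<y (refl ∷ (_ ∷ʳ s))           = av x<y (refl ∷ s)
  no1121-repeat av x<y (refl ∷ refl ∷ s)           = av x<y (refl ∷ refl ∷ drop-≢ (≢-sym (<⇒≢ x<y)) s)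

  no1121-front : ∀ {σ} → All (j <_) σ → No1121 σ → No1121 (j ∷ j ∷ σ)
  no1121-front j<σ av x<y (refl ∷ s)              =
    absent j<σ (⊆-trans (_ ∷ʳ refl ∷ []) (drop-≢ (≢-sym (<⇒≢ x<y)) (drop s)))
    where
    drop : ∀ {y σ} → j ∷ y ∷ j ∷ [] ⊆ j ∷ σ → y ∷ j ∷ [] ⊆ j ∷ σ
    drop (_ ∷ʳ s) = j ∷ʳ ⊆-trans (j ∷ʳ ⊆-refl) s
    drop (_ ∷ s)  = j ∷ʳ s
  no1121-front j<σ av x<y (_ ∷ʳ (refl ∷ s))         = absent j<σ s
  no1121-front j<σ av x<y (_ ∷ʳ (_ ∷ʳ s))           = av x<y s

  -- An occurrence starting with `x` has all its letters above `j`, so it would already lie in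
  -- `x ∷ π`.
  no1121-keep : ∀ {a x π σ} → All (j <_) (x ∷ π) → No1121 (x ∷ π) → Ins j a π σ →
                No1121 σ → No1121 (x ∷ σ)
  no1121-keep j<         av i avσ x<y (_ ∷ʳ s)   = avσ x<y s
  no1121-keep (j<x ∷ _) av i avσ x<y (refl ∷ s) =
    av x<y (restrict (keep-any i) (j<x ∷ j<x ∷ <-trans j<x x<y ∷ j<x ∷ []) (refl ∷ s))

  no1121-keep-front : ∀ {a x π σ} → All (j <_) (x ∷ π) → No1121 (x ∷ π) → Ins j a π σ →
                      No1121 (j ∷ σ) → No1121 (j ∷ x ∷ σ)
  no1121-keep-front j<@(j<x ∷ _) av i avσ x<y (_ ∷ʳ s) =
    no1121-keep j< av i (λ x<y s → avσ x<y (j ∷ʳ s)) x<y s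
  no1121-keep-front j<@(j<x ∷ _) av i avσ x<y (refl ∷ s) = avσ x<y (refl ∷ drop-≢ (<⇒≢ j<x) s)

  no1121-blocked : ∀ {a x π σ} → j < x → Ins j (suc a) π σ → ¬ No1121 (j ∷ j ∷ x ∷ σ)
  no1121-blocked j<x i av = av j<x (refl ∷ refl ∷ refl ∷ copy-⊆ i)

-- Sorted suffixes and a criterion for generating trees

sorted-replicate : {_R_ : ℕ → ℕ → Set} → ∀ {j} → j R j → ∀ n → AllPairs _R_ (replicate n j)
sorted-replicate r zero    = []
sorted-replicate r (suc n) = replicate⁺ n r ∷ sorted-replicate r n

module Suffix {_R_ : ℕ → ℕ → Set} (_R?_ : ∀ x y → Dec (x R y)) where

  Sorted : Word → Set
  Sorted = AllPairs _R_

  sorted? : ∀ σ → Dec (Sorted σ)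
  sorted? = allPairs? _R?_

  -- The number of sorted suffixes, the empty one included.
  act : Word → ℕ
  act []      = 1
  act (x ∷ σ) = choose (sorted? (x ∷ σ)) (suc (suc (length σ))) (act σ)

  act-sorted : ∀ {σ} → Sorted σ → act σ ≡ suc (length σ)
  act-sorted {[]}    _ = refl
  act-sorted {x ∷ σ} s = choose-yes (sorted? (x ∷ σ)) s

  act-unsorted : ∀ {x σ} → ¬ Sorted (x ∷ σ) → act (x ∷ σ) ≡ act σ
  act-unsorted {x} {σ} ¬s = choose-no (sorted? (x ∷ σ)) ¬s

-- Avoidance passes to sublists and the parent is a sublist of every shuffle. A parent that fails to
-- avoid thus gives 0 on both sides, and only avoiding parents need an argument.
generatingTree :
  ∀ {P} {Av : Word → Set} → (∀ σ → AvoidsAll P σ ⇔ Av σ) →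
  (av? : ∀ σ → Dec (Av σ)) (act : Word → ℕ) → Av [] → act [] ≡ 1 →
  (∀ {π σ} → π ⊆ σ → Av σ → Av π) →
  (∀ {j} a f {π} → All (j <_) π → Av π →
     insertSum j (suc a) π (λ σ → choose (av? σ) (f (act σ)) 0) ≡ children a f (act π)) →
  GeneratingTree P
generatingTree {P} {Av} e av? act av-[] act-[] av-⊆ insert = record
  { weight        = weight
  ; weight-const  = λ σ → choose-cong (avoidsAll? P σ) (av? σ)
      (Equivalence.to (e σ)) (Equivalence.from (e σ)) (λ _ → refl) (λ _ → refl)
  ; weight-[]     = λ f → trans (choose-yes (av? []) av-[]) (cong f act-[])
  ; weight-insert = λ j a f {π} j< → weight-insert a f j< (av? π)
  }
  where
  weight : (ℕ → ℕ) → Word → ℕ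
  weight f σ = choose (av? σ) (f (act σ)) 0

  weight-insert : ∀ {j} a f {π} → All (j <_) π → (d : Dec (Av π)) →
                  insertSum j (suc a) π (weight f) ≡ choose d (children a f (act π)) 0
  weight-insert a f j< (yes av) = insert a f j< av
  weight-insert {j} a f {π} j< (no ¬av) =
    insertSum-zero {j} {suc a} {π} (λ {σ} i → choose-no (av? σ) (¬av ∘ av-⊆ (Ins-⊆ i)))

-- The class of 123 and 1121

module Class123 where
  open Suffix _≥?_

  Av : Word → Set
  Av σ = No123 σ × No1121 σ

  av? : ∀ σ → Dec (Av σ)
  av? σ = avoids? avoids-123 σ ×-dec avoids? avoids-1121 σ

  weight : (ℕ → ℕ) → Word → ℕ
  weight f σ = choose (av? σ) (f (act σ)) 0

  av-⊆ : ∀ {π σ} → π ⊆ σ → Av σ → Av π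
  av-⊆ π⊆σ (av , av′) = (λ x<y y<z s → av x<y y<z (⊆-trans s π⊆σ)) , (λ x<y s → av′ x<y (⊆-trans s π⊆σ))

  av-tail : ∀ {x σ} → Av (x ∷ σ) → Av σ
  av-tail = av-⊆ (_ ∷ʳ ⊆-refl)

  sorted⇒av : ∀ {σ} → Sorted σ → Av σ
  sorted⇒av srt =
    (λ x<y _ s → <⇒≱ x<y (AllPairs⇒sublists srt (⊆-trans (refl ∷ refl ∷ _ ∷ʳ []) s))) ,
    (λ x<y s → <⇒≱ x<y (AllPairs⇒sublists srt (⊆-trans (_ ∷ʳ refl ∷ refl ∷ _ ∷ʳ []) s)))

  module _ {j : ℕ} where

    av-keep : ∀ {a x π σ} → All (j <_) (x ∷ π) → Av (x ∷ π) → Ins j a π σ → Av σ → Av (x ∷ σ)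
    av-keep {x = x} {σ = σ} j<@(j<x ∷ _) (av , av′) i (avσ , avσ′) = no123 , no1121-keep j< av′ i avσ′
      where
      no123 : No123 (x ∷ σ)
      no123 x<y y<z (_ ∷ʳ s)   = avσ x<y y<z s
      no123 x<y y<z (refl ∷ s) =
        av x<y y<z (restrict (keep-any i) (j<x ∷ <-trans j<x x<y ∷ <-trans j<x (<-trans x<y y<z) ∷ []) (refl ∷ s))

    av-repeat : ∀ {σ} → Av (j ∷ j ∷ σ) → Av (j ∷ j ∷ j ∷ σ)
    av-repeat {σ} (av , av′) = no123 , no1121-repeat av′
      where
      no123 : No123 (j ∷ j ∷ j ∷ σ)
      no123 x<y y<z (_ ∷ʳ s)            = av x<y y<z s
      no123 x<y y<z (refl ∷ (_ ∷ʳ s))   = av x<y y<z (refl ∷ s)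
      no123 x<y y<z (refl ∷ (refl ∷ s)) = n≮n _ x<y

    av-front : ∀ {σ} → All (j <_) σ → Sorted σ → Av (j ∷ j ∷ σ)
    av-front {σ} j<σ srt = no123 , no1121-front j<σ (proj₂ (sorted⇒av srt))
      where
      no123 : No123 (j ∷ j ∷ σ)
      no123 x<y y<z (_ ∷ʳ (_ ∷ʳ s))   = proj₁ (sorted⇒av srt) x<y y<z s
      no123 x<y y<z (_ ∷ʳ (refl ∷ s)) = <⇒≱ y<z (AllPairs⇒sublists srt s)
      no123 x<y y<z (refl ∷ (_ ∷ʳ s)) = <⇒≱ y<z (AllPairs⇒sublists srt s)
      no123 x<y y<z (refl ∷ refl ∷ s) = n≮n _ x<y

    -- A 123 through both `j` and `x` would need an ascent from `x` among letters above `j`, which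
    -- the weakly decreasing `x ∷ π` excludes.
    av-keep-front : ∀ {a x π σ} → All (j <_) (x ∷ π) → Sorted (x ∷ π) → Ins j a π σ →
                    Av (j ∷ σ) → Av (j ∷ x ∷ σ)
    av-keep-front {x = x} {σ = σ} j<@(j<x ∷ _) srt i (av , av′) =
      no123 , no1121-keep-front j< (proj₂ (sorted⇒av srt)) i av′
      where
      no123 : No123 (j ∷ x ∷ σ)
      no123 x<y y<z (_ ∷ʳ s) =
        proj₁ (av-keep j< (sorted⇒av srt) i (av-tail (av , av′))) x<y y<z s
      no123 x<y y<z (refl ∷ (_ ∷ʳ s)) = av x<y y<z (refl ∷ s)
      no123 x<y y<z (refl ∷ (refl ∷ s)) =
        <⇒≱ y<z (AllPairs⇒sublists srt (restrict (keep-any i) (j<x ∷ <-trans j<x y<z ∷ []) (refl ∷ s)))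

    sorted-keep : ∀ {a x π σ} → j < x → Sorted (x ∷ π) → Ins j a π σ → Sorted σ → Sorted (x ∷ σ)
    sorted-keep j<x (x≥π ∷ _) i srt = Ins-all (<⇒≤ j<x) x≥π i ∷ srt

    unsorted-front : ∀ {a x π σ} → j < x → Ins j a (x ∷ π) σ → ¬ Sorted (j ∷ σ)
    unsorted-front j<x i srt =
      <⇒≱ j<x (AllPairs⇒sublists srt (refl ∷ ⊆-trans (refl ∷ minimum _) (Ins-⊆ i)))

    -- Prepending letters changes the number of sorted suffixes of a sorted
    -- shuffle only, so its label is a parameter g.
    label : ℕ → (ℕ → ℕ) → Word → ℕ
    label g f σ = choose (sorted? σ) g (f (act σ))

    label-keep : ∀ {g f a x π σ} → All (j <_) (x ∷ π) → Sorted (x ∷ π) → Ins j a π σ →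
             label g f (x ∷ σ) ≡ label g f σ
    label-keep {f = f} {x = x} {σ = σ} (j<x ∷ _) srt i =
      choose-cong (sorted? (x ∷ σ)) (sorted? σ) AllPairs.tail (sorted-keep j<x srt i)
        (λ _ → refl) (λ ¬s → cong f (act-unsorted (¬s ∘ AllPairs.tail)))

    -- Avoidance is tested with a copy of `j` in front, but the label is read from `σ`: when a
    -- larger letter follows that copy, the whole word is unsorted and the copy adds no active site.
    frontWeight : ℕ → (ℕ → ℕ) → Word → ℕ
    frontWeight g f σ = choose (av? (j ∷ σ)) (label g f σ) 0

    -- A second copy next to the front one forces all others into the same run, since a copy behind
    -- `x` would complete 1121. Only one shuffle survives, and its sorted suffixes are those of
    -- `x ∷ π`.
    frontWeight-run : ∀ b g f {x π} → All (j <_) (x ∷ π) → Sorted (x ∷ π) →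
                      insertSum j b (x ∷ π) (frontWeight g f ∘ (j ∷_)) ≡ f (suc (suc (length π)))
    frontWeight-run zero g f {x} {π} j<@(j<x ∷ _) srt =
      trans (choose-yes (av? (j ∷ j ∷ x ∷ π)) (av-front j< srt))
        (trans (choose-no (sorted? (j ∷ x ∷ π)) ¬s)
          (cong f (trans (act-unsorted ¬s) (act-sorted srt))))
      where
      ¬s : ¬ Sorted (j ∷ x ∷ π)
      ¬s = unsorted-front j<x (stop {π = x ∷ π})
    frontWeight-run (suc b) g f {x} {π} j<@(j<x ∷ _) srt =
      trans (cong₂ _+_
              (trans (insertSum-cong {j} {b} repeat) (frontWeight-run b g f j< srt))
              (insertSum-zero {j} {suc b} {π} (λ {σ} i →
                choose-no (av? (j ∷ j ∷ x ∷ σ)) (no1121-blocked j<x i ∘ proj₂))))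
        (+-identityʳ _)
      where
      repeat : ∀ {σ} → Ins j b (x ∷ π) σ → frontWeight g f (j ∷ j ∷ σ) ≡ frontWeight g f (j ∷ σ)
      repeat {σ} i =
        choose-cong (av? (j ∷ j ∷ j ∷ σ)) (av? (j ∷ j ∷ σ)) av-tail av-repeat
          (λ _ → choose-cong (sorted? (j ∷ j ∷ σ)) (sorted? (j ∷ σ)) AllPairs.tail
                   (λ s → contradiction s (unsorted-front j<x i)) (λ _ → refl)
                   (λ ¬s → cong f (act-unsorted (¬s ∘ AllPairs.tail))))
          (λ _ → refl)

    -- Behind the front copy the others must stay together. Before a nonempty suffix of length r
    -- they leave r + 1 active sites; at the end they give the only sorted shuffle, with label `g`.
    frontWeight-sum : ∀ b g f {π} → All (j <_) π → Sorted π →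
                      insertSum j (suc b) π (frontWeight g f) ≡ g + sumFrom2 f (length π)
    frontWeight-sum b g f {[]} _ _ =
      trans (insertSum-[] b)
        (trans (choose-yes (av? (j ∷ j ∷ replicate b j)) (sorted⇒av (sorted-replicate ≤-refl (suc (suc b)))))
          (trans (choose-yes (sorted? (j ∷ replicate b j)) (sorted-replicate ≤-refl (suc b)))
            (sym (+-identityʳ g))))
    frontWeight-sum b g f {x ∷ π} j<@(_ ∷ j<π) srt@(_ ∷ srtπ) =
      trans (cong₂ _+_ (frontWeight-run b g f j< srt)
              (trans (insertSum-cong {j} {suc b} {π} keep-frontWeight) (frontWeight-sum b g f j<π srtπ)))
        (rotate (f (suc (suc (length π)))) g (sumFrom2 f (length π)))
      where
      rotate : ∀ x y z → x + (y + z) ≡ y + (z + x)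
      rotate = solve-∀
      keep-frontWeight : ∀ {σ} → Ins j (suc b) π σ → frontWeight g f (x ∷ σ) ≡ frontWeight g f σ
      keep-frontWeight {σ} i =
        choose-cong (av? (j ∷ x ∷ σ)) (av? (j ∷ σ)) (av-⊆ (refl ∷ _ ∷ʳ ⊆-refl))
          (av-keep-front j< srt i) (λ _ → label-keep {g} {f} j< srt i) (λ _ → refl)

    labelled : ℕ → (ℕ → ℕ) → Word → ℕ
    labelled g f σ = choose (av? σ) (label g f σ) 0

    labelled-front : ∀ a g f {x π} → All (j <_) (x ∷ π) → Sorted (x ∷ π) →
              insertSum j a (x ∷ π) (labelled g f ∘ (j ∷_)) ≡
              f (suc (suc (a + length π))) + extra a f (suc (length π))
    labelled-front zero g f {x} {π} j<@(j<x ∷ _) srt =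
      trans (choose-yes (av? (j ∷ x ∷ π)) (av-tail (av-front j< srt)))
        (trans (choose-no (sorted? (j ∷ x ∷ π)) ¬s)
          (trans (cong f (trans (act-unsorted ¬s) (act-sorted srt))) (sym (+-identityʳ _))))
      where
      ¬s : ¬ Sorted (j ∷ x ∷ π)
      ¬s = unsorted-front j<x (stop {π = x ∷ π})
    labelled-front (suc b) g f {x} {π} j<@(j<x ∷ _) srt =
      trans (insertSum-cong {j} {suc b} {x ∷ π} to-frontWeight) (frontWeight-sum b g′ f j< srt)
      where
      g′ : ℕ
      -- With the remaining copies all at the end, `σ` is sorted of length `suc b + suc (length π)`
      -- and has one active site more.
      g′ = f (suc (suc (suc b + length π)))
      to-frontWeight : ∀ {σ} → Ins j (suc b) (x ∷ π) σ → labelled g f (j ∷ σ) ≡ frontWeight g′ f σ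
      to-frontWeight {σ} i = cong (λ n → choose (av? (j ∷ σ)) n 0)
        (trans (choose-no (sorted? (j ∷ σ)) ¬s)
          (trans (cong f (act-unsorted ¬s)) (sym (f-act (sorted? σ)))))
        where
        ¬s : ¬ Sorted (j ∷ σ)
        ¬s = unsorted-front j<x i
        f-act : (d : Dec (Sorted σ)) → choose d g′ (f (act σ)) ≡ f (act σ)
        f-act (yes s) = cong f (sym (trans (act-sorted s)
          (cong suc (trans (Ins-length i) (+-suc (suc b) (length π))))))
        f-act (no _) = refl

    -- The unsorted shuffles, grouped by the suffix behind the first copy. Here
    -- `f (suc (suc (a + n)))` goes with `extra a f (suc n)`, whereas `children` pairs it with
    -- `extra a f n`; adding the sorted shuffle repairs the offset.
    sortedChildren : ℕ → (ℕ → ℕ) → ℕ → ℕ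
    sortedChildren a f zero    = 0
    sortedChildren a f (suc n) = sortedChildren a f n + (f (suc (suc (a + n))) + extra a f (suc n))

    labelled-sum : ∀ a g f {π} → All (j <_) π → Sorted π →
            insertSum j (suc a) π (labelled g f) ≡ g + sortedChildren a f (length π)
    labelled-sum a g f {[]} _ _ =
      trans (insertSum-[] a)
        (trans (choose-yes (av? (j ∷ replicate a j)) (sorted⇒av (sorted-replicate ≤-refl (suc a))))
          (trans (choose-yes (sorted? (j ∷ replicate a j)) (sorted-replicate ≤-refl (suc a)))
            (sym (+-identityʳ g))))
    labelled-sum a g f {x ∷ π} j<@(_ ∷ j<π) srt@(_ ∷ srtπ) =
      trans (cong₂ _+_ (labelled-front a g f j< srt)
              (trans (insertSum-cong {j} {suc a} {π} keep-labelled) (labelled-sum a g f j<π srtπ)))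
        (rotate _ g (sortedChildren a f (length π)))
      where
      rotate : ∀ x y z → x + (y + z) ≡ y + (z + x)
      rotate = solve-∀
      keep-labelled : ∀ {σ} → Ins j (suc a) π σ → labelled g f (x ∷ σ) ≡ labelled g f σ
      keep-labelled {σ} i =
        choose-cong (av? (x ∷ σ)) (av? σ) av-tail
          (av-keep j< (sorted⇒av srt) i) (λ _ → label-keep {g} {f} j< srt i) (λ _ → refl)

    children-sorted : ∀ a f n → children a f (suc n) ≡ f (suc (suc (a + n))) + sortedChildren a f n
    children-sorted a f zero    = trans (children-1 a f) (sym (+-identityʳ _))
    children-sorted a f (suc n) =
      trans (cong (_+ (f (suc (suc (a + suc n))) + extra a f (suc n))) (children-sorted a f n))
        (rearrange (f (suc (suc (a + n)))) (sortedChildren a f n) (f (suc (suc (a + suc n)))) (extra a f (suc n)))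
      where
      rearrange : ∀ x d y e → (x + d) + (y + e) ≡ y + (d + (x + e))
      rearrange = solve-∀

    insert-sorted : ∀ a f {π} → All (j <_) π → Sorted π →
                    insertSum j (suc a) π (weight f) ≡ children a f (act π)
    insert-sorted a f {π} j< srt =
      trans (insertSum-cong {j} {suc a} {π} to-labelled)
        (trans (labelled-sum a (f (suc (suc (a + length π)))) f j< srt)
          (sym (trans (cong (children a f) (act-sorted srt)) (children-sorted a f (length π)))))
      where
      to-labelled : ∀ {σ} → Ins j (suc a) π σ → weight f σ ≡ labelled (f (suc (suc (a + length π)))) f σ
      to-labelled {σ} i = cong (λ n → choose (av? σ) n 0) (sym (f-act (sorted? σ)))
        where
        f-act : (d : Dec (Sorted σ)) → choose d (f (suc (suc (a + length π)))) (f (act σ)) ≡ f (act σ)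
        f-act (yes s) = cong f (sym (trans (act-sorted s) (cong suc (Ins-length i))))
        f-act (no _)  = refl

    insert-av : ∀ a f {π} → All (j <_) π → Av π →
                insertSum j (suc a) π (weight f) ≡ children a f (act π)
    insert-av a f {[]}    _  _  = insert-sorted a f [] []
    insert-av a f {x ∷ π} j<@(_ ∷ j<π) av with sorted? (x ∷ π)
    ... | yes srt = insert-sorted a f j< srt
    ... | no ¬srt =
      -- A copy before an unsorted suffix has an ascent behind it and completes 123, so `x` is
      -- simply skipped.
      trans (cong₂ _+_ (insertSum-zero {j} {a} {x ∷ π} front-zero)
              (trans (insertSum-cong {j} {suc a} {π} keep-weight) (insert-av a f j<π (av-tail av))))
        (cong (children a f) (sym (act-unsorted ¬srt)))
      where
      front-zero : ∀ {σ} → Ins j a (x ∷ π) σ → weight f (j ∷ σ) ≡ 0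
      front-zero {σ} i = choose-no (av? (j ∷ σ)) λ (av , _) →
        ¬srt (sublists⇒AllPairs λ s → ≮⇒≥ λ x<y →
          av (All.head (All-resp-⊆ s j<)) x<y (refl ∷ ⊆-trans s (Ins-⊆ i)))
      keep-weight : ∀ {σ} → Ins j (suc a) π σ → weight f (x ∷ σ) ≡ weight f σ
      keep-weight {σ} i =
        choose-cong (av? (x ∷ σ)) (av? σ) av-tail (av-keep j< av i)
          (λ _ → cong f (act-unsorted λ srt →
            ¬srt (sublists⇒AllPairs (AllPairs⇒sublists srt ∘ (λ s → ⊆-trans s (refl ∷ Ins-⊆ i))))))
          (λ _ → refl)

  tree : GeneratingTree (p123 ∷ p1121 ∷ [])
  tree = generatingTree (avoidsAll-pair avoids-123 avoids-1121) av? act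
    (sorted⇒av []) refl av-⊆ insert-av

-- The class of 132 and 1211

module Class132 where
  open Suffix _≤?_

  Av : Word → Set
  Av σ = No132 σ × No1211 σ

  av? : ∀ σ → Dec (Av σ)
  av? σ = avoids? avoids-132 σ ×-dec avoids? avoids-1211 σ

  weight : (ℕ → ℕ) → Word → ℕ
  weight f σ = choose (av? σ) (f (act σ)) 0

  av-⊆ : ∀ {π σ} → π ⊆ σ → Av σ → Av π
  av-⊆ π⊆σ (av , av′) = (λ x<y y<z s → av x<y y<z (⊆-trans s π⊆σ)) , (λ x<y s → av′ x<y (⊆-trans s π⊆σ))

  av-tail : ∀ {x σ} → Av (x ∷ σ) → Av σ
  av-tail = av-⊆ (_ ∷ʳ ⊆-refl)

  sorted⇒av : ∀ {σ} → Sorted σ → Av σ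
  sorted⇒av srt =
    (λ _ y<z s → <⇒≱ y<z (AllPairs⇒sublists srt (⊆-trans (_ ∷ʳ refl ∷ refl ∷ []) s))) ,
    (λ x<y s → <⇒≱ x<y (AllPairs⇒sublists srt (⊆-trans (_ ∷ʳ refl ∷ refl ∷ _ ∷ʳ []) s)))

  module _ {j : ℕ} where

    av-keep : ∀ {a x π σ} → All (j <_) (x ∷ π) → Av (x ∷ π) → Ins j a π σ → Av σ → Av (x ∷ σ)
    av-keep {x = x} {σ = σ} (j<x ∷ _) (av , av′) i (avσ , avσ′) = no132 , no1211
      where
      no132 : No132 (x ∷ σ)
      no132 x<y y<z (_ ∷ʳ s)   = avσ x<y y<z s
      no132 x<y y<z (refl ∷ s) =
        av x<y y<z (restrict (keep-any i) (j<x ∷ <-trans j<x (<-trans x<y y<z) ∷ <-trans j<x x<y ∷ []) (refl ∷ s))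
      no1211 : No1211 (x ∷ σ)
      no1211 x<y (_ ∷ʳ s)   = avσ′ x<y s
      no1211 x<y (refl ∷ s) =
        av′ x<y (restrict (keep-any i) (j<x ∷ <-trans j<x x<y ∷ j<x ∷ j<x ∷ []) (refl ∷ s))

    av-repeat : ∀ {σ} → Av (j ∷ σ) → Av (j ∷ j ∷ σ)
    av-repeat {σ} (av , av′) = no132 , no1211
      where
      no132 : No132 (j ∷ j ∷ σ)
      no132 x<y y<z (_ ∷ʳ s)          = av x<y y<z s
      no132 x<y y<z (refl ∷ (_ ∷ʳ s)) = av x<y y<z (refl ∷ s)
      no132 x<y y<z (refl ∷ refl ∷ s) = n≮n _ (<-trans x<y y<z)
      no1211 : No1211 (j ∷ j ∷ σ)
      no1211 x<y (_ ∷ʳ s)          = av′ x<y s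
      no1211 x<y (refl ∷ (_ ∷ʳ s)) = av′ x<y (refl ∷ s)
      no1211 x<y (refl ∷ refl ∷ s) = n≮n _ x<y

    two-copies : ∀ {a π σ} → Ins j (suc (suc a)) π σ → j ∷ j ∷ [] ⊆ σ
    two-copies (put i)          = refl ∷ copy-⊆ i
    two-copies (keep {x = x} i) = x ∷ʳ two-copies i

    one-copy : ∀ {π σ} → All (j <_) π → Ins j 1 π σ → ¬ (j ∷ j ∷ [] ⊆ σ)
    one-copy j<π         (put stop) s = absent j<π (tail-⊆ s)
    one-copy (j<x ∷ j<π) (keep i)   s = one-copy j<π i (drop-≢ (<⇒≢ j<x) s)

    -- Either pattern would need a descent among letters above `j`, impossible in the weakly
    -- increasing `x ∷ π`, or a third copy of `j`.
    av-single : ∀ {x π σ} → All (j <_) (x ∷ π) → Sorted (x ∷ π) → Ins j 1 π σ → Av (j ∷ x ∷ σ)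
    av-single {x} {π} {σ} (j<x ∷ j<π) srt i = no132 , no1211
      where
      descent : ∀ {x′ y} → j < x′ → x′ < y → ¬ (y ∷ x′ ∷ [] ⊆ x ∷ σ)
      descent j<x′ x′<y s =
        <⇒≱ x′<y (AllPairs⇒sublists srt (restrict (keep i) (<-trans j<x′ x′<y ∷ j<x′ ∷ []) s))
      j≤ : All (j ≤_) (j ∷ x ∷ σ)
      j≤ = ≤-refl ∷ <⇒≤ j<x ∷ Ins-all ≤-refl (All.map <⇒≤ j<π) i
      no132 : No132 (j ∷ x ∷ σ)
      no132 x<y y<z s = descent (≤-<-trans (All.head (All-resp-⊆ s j≤)) x<y) y<z (tail-⊆ s)
      no1211 : No1211 (j ∷ x ∷ σ)
      no1211 x<y s with m≤n⇒m<n∨m≡n (All.head (All-resp-⊆ s j≤))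
      ... | inj₁ j<x  = descent j<x x<y (⊆-trans (refl ∷ refl ∷ _ ∷ʳ []) (tail-⊆ s))
      ... | inj₂ refl = one-copy j<π i (tail-⊆ (tail-⊆ s))

    unsorted : ∀ {a x π σ} → j < x → Ins j (suc a) π σ → ¬ Sorted (x ∷ σ)
    unsorted j<x i srt = <⇒≱ j<x (AllPairs⇒sublists srt (refl ∷ copy-⊆ i))

    -- A copy before a suffix of length r makes a sorted suffix of length r + 1, and the larger
    -- letter preceding it, if any, ends sortedness. This leaves r + 2 active sites, for r from 0 to
    -- `length π`.
    single-sum : ∀ f {π} → All (j <_) π → Sorted π →
                 insertSum j 1 π (f ∘ act) ≡ sumFrom2 f (suc (length π))
    single-sum f {[]}    _ _ = refl
    single-sum f {x ∷ π} j<@(j<x ∷ j<π) srt@(_ ∷ srtπ) =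
      trans (cong₂ _+_ (cong f (act-sorted (All.map <⇒≤ j< ∷ srt)))
              (trans (insertSum-cong {j} {1} {π} (λ i → cong f (act-unsorted (unsorted j<x i))))
                (single-sum f j<π srtπ)))
        (+-comm _ (sumFrom2 f (suc (length π))))

    -- The label of a sorted `j ∷ σ` depends on its length. Fixing it as `g` makes the weight
    -- invariant under deleting a repeated front copy.
    frontWeight : ℕ → (ℕ → ℕ) → Word → ℕ
    frontWeight g f σ = choose (av? (j ∷ σ)) (choose (sorted? (j ∷ σ)) g (f (act σ))) 0

    frontWeight-repeat : ∀ g f σ → frontWeight g f (j ∷ σ) ≡ frontWeight g f σ
    frontWeight-repeat g f σ =
      choose-cong (av? (j ∷ j ∷ σ)) (av? (j ∷ σ)) av-tail av-repeat
        (λ _ → choose-cong (sorted? (j ∷ j ∷ σ)) (sorted? (j ∷ σ)) AllPairs.tail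
                 (λ { srt@(j≤σ ∷ _) → (≤-refl ∷ j≤σ) ∷ srt })
                 (λ _ → refl) (cong f ∘ act-unsorted))
        (λ _ → refl)

    -- A single remaining copy may go to any later site. Of two or more, one must join the front,
    -- since two copies behind `x` complete 1211 with the front copy.
    frontWeight-sum : ∀ a g f {x π} → All (j <_) (x ∷ π) → Sorted (x ∷ π) →
            insertSum j a (x ∷ π) (frontWeight g f) ≡ g + extra a f (suc (length π))
    frontWeight-sum zero g f {x} {π} j< srt =
      trans (choose-yes (av? (j ∷ x ∷ π)) (sorted⇒av srt′))
        (trans (choose-yes (sorted? (j ∷ x ∷ π)) srt′) (sym (+-identityʳ g)))
      where
      srt′ : Sorted (j ∷ x ∷ π)
      srt′ = All.map <⇒≤ j< ∷ srt
    frontWeight-sum (suc zero) g f {x} {π} j<@(j<x ∷ j<π) srt@(_ ∷ srtπ) =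
      cong₂ _+_ (trans (frontWeight-repeat g f (x ∷ π)) (trans (frontWeight-sum zero g f j< srt) (+-identityʳ g)))
        (trans (insertSum-cong {j} {1} {π} first-kept) (single-sum f j<π srtπ))
      where
      first-kept : ∀ {σ} → Ins j 1 π σ → frontWeight g f (x ∷ σ) ≡ f (act σ)
      first-kept {σ} i =
        trans (choose-yes (av? (j ∷ x ∷ σ)) (av-single j< srt i))
          (trans (choose-no (sorted? (j ∷ x ∷ σ)) (unsorted j<x i ∘ AllPairs.tail))
            (cong f (act-unsorted (unsorted j<x i))))
    frontWeight-sum (suc (suc b)) g f {x} {π} j<@(j<x ∷ _) srt =
      trans (cong₂ _+_
              (trans (insertSum-cong {j} {suc b} {x ∷ π} (λ {σ} _ → frontWeight-repeat g f σ)) (frontWeight-sum (suc b) g f j< srt))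
              (insertSum-zero {j} {suc (suc b)} {π} (λ {σ} i → choose-no (av? (j ∷ x ∷ σ))
                (λ (_ , av) → av j<x (refl ∷ refl ∷ two-copies i)))))
        (+-identityʳ _)

    insert-av : ∀ a f {π} → All (j <_) π → Av π →
                insertSum j (suc a) π (weight f) ≡ children a f (act π)
    insert-av a f {[]} _ _ =
      trans (insertSum-[] a)
        (trans (choose-yes (av? (j ∷ replicate a j)) (sorted⇒av srt))
          (trans (cong f (trans (act-sorted srt) (cong (2 +_) (trans (length-replicate a) (sym (+-identityʳ a))))))
            (sym (children-1 a f))))
      where
      srt : Sorted (j ∷ replicate a j)
      srt = sorted-replicate ≤-refl (suc a)
    insert-av a f {x ∷ π} j<@(j<x ∷ j<π) av =
      trans (cong (insertSum j a (x ∷ π) (weight f ∘ (j ∷_)) +_)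
              (trans (insertSum-cong {j} {suc a} {π} keep-weight) (insert-av a f j<π (av-tail av))))
        (front (sorted? (x ∷ π)))
      where
      keep-weight : ∀ {σ} → Ins j (suc a) π σ → weight f (x ∷ σ) ≡ weight f σ
      keep-weight {σ} i =
        choose-cong (av? (x ∷ σ)) (av? σ) av-tail (av-keep j< av i)
          (λ _ → cong f (act-unsorted (unsorted j<x i))) (λ _ → refl)

      front : Dec (Sorted (x ∷ π)) →
              insertSum j a (x ∷ π) (weight f ∘ (j ∷_)) + children a f (act π) ≡ children a f (act (x ∷ π))
      front (no ¬srt) =
        cong₂ _+_ (insertSum-zero {j} {a} {x ∷ π} front-zero) (cong (children a f) (sym (act-unsorted ¬srt)))
        where
        front-zero : ∀ {σ} → Ins j a (x ∷ π) σ → weight f (j ∷ σ) ≡ 0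
        front-zero {σ} i = choose-no (av? (j ∷ σ)) λ (av , _) →
          ¬srt (sublists⇒AllPairs λ s → ≮⇒≥ λ y<x →
            av (All.head (All.tail (All-resp-⊆ s j<))) y<x (refl ∷ ⊆-trans s (Ins-⊆ i)))
      front (yes srt@(_ ∷ srtπ)) =
        trans (cong₂ _+_ (trans (insertSum-cong {j} {a} {x ∷ π} to-frontWeight) (frontWeight-sum a g f j< srt))
                         (cong (children a f) (act-sorted srtπ)))
          (trans (+-comm _ (children a f (suc (length π))))
            (cong (children a f) (sym (act-sorted srt))))
        where
        g : ℕ
        -- All copies in front of the sorted `x ∷ π` give a sorted word of length
        -- `suc a + suc (length π)`.
        g = f (suc (suc (a + suc (length π))))
        to-frontWeight : ∀ {σ} → Ins j a (x ∷ π) σ → weight f (j ∷ σ) ≡ frontWeight g f σ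
        to-frontWeight {σ} i = cong (λ n → choose (av? (j ∷ σ)) n 0) (sym (f-act (sorted? (j ∷ σ))))
          where
          f-act : (d : Dec (Sorted (j ∷ σ))) → choose d g (f (act σ)) ≡ f (act (j ∷ σ))
          f-act (yes s) = cong f (sym (trans (act-sorted s) (cong (2 +_) (Ins-length i))))
          f-act (no ¬s) = cong f (sym (act-unsorted ¬s))

  tree : GeneratingTree (p132 ∷ p1211 ∷ [])
  tree = generatingTree (avoidsAll-pair avoids-132 avoids-1211) av? act
    (sorted⇒av []) refl av-⊆ insert-av

-- The succession rule split by the leftmost copy

sumFrom2-shift : ∀ f m → sumFrom2 f (suc m) ≡ sumFrom2 (f ∘ suc) m + f 2
sumFrom2-shift f zero    = refl
sumFrom2-shift f (suc m) =
  trans (cong (_+ f (suc (suc (suc m)))) (sumFrom2-shift f m))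
    (xyz (sumFrom2 (f ∘ suc) m) (f 2) _)
  where
  xyz : ∀ x y z → x + y + z ≡ x + z + y
  xyz = solve-∀

-- Take `suc m` active sites and the first copy at the leftmost. The other `a` copies at the end
-- give label `a + 2`; for positive `a`, putting them at any of the `m` sites before the end, the
-- leftmost included, gives label 2. A first copy further right gains the leftmost site, whence
-- `f ∘ suc`.
children-shift : ∀ a f m → children a f (suc m) ≡
                 (f (suc (suc a)) + extra a (const (f 2)) m) + children a (f ∘ suc) m
children-shift a f zero =
  trans (children-1 a f) (trans (cong (f ∘ (2 +_)) (+-identityʳ a))
    (sym (trans (+-identityʳ _) (trans (cong (f (suc (suc a)) +_) (extra-0 a)) (+-identityʳ _)))))
  where
  extra-0 : ∀ a → extra a (const (f 2)) 0 ≡ 0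
  extra-0 zero    = refl
  extra-0 (suc a) = refl
children-shift a f (suc m) =
  trans (cong₂ _+_ (children-shift a f m) (cong (λ n → f (suc (suc n)) + extra a f (suc m)) (+-suc a m)))
    (trans (rearrange (f (suc (suc a))) (extra a (const (f 2)) m) (children a (f ∘ suc) m) (f (suc (suc (suc (a + m))))) _)
      (trans (cong (λ e → f (suc (suc a)) + (children a (f ∘ suc) m + (f (suc (suc (suc (a + m)))) + e))) (extra-shift a))
        (rearrange′ (f (suc (suc a))) (children a (f ∘ suc) m) (f (suc (suc (suc (a + m)))))
          (extra a (const (f 2)) (suc m)) (extra a (f ∘ suc) m))))
  where
  rearrange : ∀ x e c y e′ → ((x + e) + c) + (y + e′) ≡ x + (c + (y + (e + e′)))
  rearrange = solve-∀
  rearrange′ : ∀ x c y e e′ → x + (c + (y + (e + e′))) ≡ (x + e) + (c + (y + e′))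
  rearrange′ = solve-∀
  swap : ∀ x y z → x + (y + z) ≡ (x + z) + y
  swap = solve-∀
  extra-shift : ∀ a → extra a (const (f 2)) m + extra a f (suc m) ≡
                      extra a (const (f 2)) (suc m) + extra a (f ∘ suc) m
  extra-shift zero    = refl
  extra-shift (suc a) =
    trans (cong (sumFrom2 (const (f 2)) m +_) (sumFrom2-shift f m))
      (swap (sumFrom2 (const (f 2)) m) (sumFrom2 (f ∘ suc) m) (f 2))

-- The class of 213 and 1121

module Class213 where

  Av : Word → Set
  Av σ = No213 σ × No1121 σ

  no213? : ∀ σ → Dec (No213 σ)
  no213? = avoids? avoids-213

  no1121? : ∀ σ → Dec (No1121 σ)
  no1121? = avoids? avoids-1121

  no213-⊆ : ∀ {π σ} → π ⊆ σ → No213 σ → No213 π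
  no213-⊆ π⊆σ free x<y y<z s = free x<y y<z (⊆-trans s π⊆σ)

  no1121-⊆ : ∀ {π σ} → π ⊆ σ → No1121 σ → No1121 π
  no1121-⊆ π⊆σ free x<y s = free x<y (⊆-trans s π⊆σ)

  below? : ∀ s σ → Dec (All (_≤ s) σ)
  below? s = All.all? (_≤? s)

  -- The number of factorisations σ = u ++ v with v nonempty in which every
  -- letter of v is at most s and at most every letter of u.
  inner : ℕ → Word → ℕ
  inner s []      = 0
  inner s (x ∷ σ) = choose (below? s (x ∷ σ)) 1 0 + inner (x ⊓ s) σ

  inner-below : ∀ {s x σ} → All (_≤ s) (x ∷ σ) → inner s (x ∷ σ) ≡ suc (inner (x ⊓ s) σ)
  inner-below {s} {x} {σ} ≤s = cong (_+ inner (x ⊓ s) σ) (choose-yes (below? s (x ∷ σ)) ≤s)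

  inner-not-below : ∀ {s x σ} → ¬ All (_≤ s) (x ∷ σ) → inner s (x ∷ σ) ≡ inner (x ⊓ s) σ
  inner-not-below {s} {x} {σ} ≰s = cong (_+ inner (x ⊓ s) σ) (choose-no (below? s (x ∷ σ)) ≰s)

  -- The bound is forgotten after one letter, because `x ⊓ s` is then `x`; any upper bound can
  -- therefore stand for an empty preceding word.
  inner-bound : ∀ {s t σ} → All (_≤ s) σ → All (_≤ t) σ → inner s σ ≡ inner t σ
  inner-bound {σ = []}    _  _  = refl
  inner-bound {s} {t} {x ∷ σ} ≤s@(x≤s ∷ _) ≤t@(x≤t ∷ _) =
    trans (inner-below ≤s) (trans (cong (λ r → suc (inner r σ)) (trans (m≤n⇒m⊓n≡m x≤s) (sym (m≤n⇒m⊓n≡m x≤t))))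
      (sym (inner-below ≤t)))

  act : Word → ℕ
  act σ = suc (inner (max 0 σ) σ)

  -- Av relative to a preceding word whose least letter is s.
  AvAfter : ℕ → Word → Set
  AvAfter s σ = No213 (s ∷ σ) × No1121 σ

  av? : ∀ σ → Dec (Av σ)
  av? σ = no213? σ ×-dec no1121? σ

  avAfter? : ∀ s σ → Dec (AvAfter s σ)
  avAfter? s σ = no213? (s ∷ σ) ×-dec no1121? σ

  weightAfter : ℕ → (ℕ → ℕ) → Word → ℕ
  weightAfter s f σ = choose (avAfter? s σ) (f (suc (inner s σ))) 0

  ⊓-∷-⊆ : ∀ s x σ → (x ⊓ s) ∷ σ ⊆ s ∷ x ∷ σ
  ⊓-∷-⊆ s x σ with ⊓-sel x s
  ... | inj₁ eq rewrite eq = s ∷ʳ ⊆-refl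
  ... | inj₂ eq rewrite eq = refl ∷ x ∷ʳ ⊆-refl

  avAfter-tail : ∀ {s x σ} → AvAfter s (x ∷ σ) → AvAfter (x ⊓ s) σ
  avAfter-tail {s} {x} {σ} (free , free′) = no213-⊆ (⊓-∷-⊆ s x σ) free , no1121-⊆ (x ∷ʳ ⊆-refl) free′

  nonincreasing⇒no213 : ∀ {σ} → AllPairs _≥_ σ → No213 σ
  nonincreasing⇒no213 srt x<y y<z s =
    <⇒≱ (<-trans x<y y<z) (AllPairs⇒sublists srt (⊆-trans (_ ∷ʳ ⊆-refl) s))

  module _ {j : ℕ} where

    -- A 213 whose least letter exceeds `j` lies in the old word. If its least letter is a copy of
    -- `j`, the letter before that copy may be replaced by a smaller one above `j`, so `x ⊓ s`
    -- represents both `s` and `x`.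
    no213-keep : ∀ {a s x π σ} → j < s → All (j <_) (x ∷ π) → No213 (s ∷ x ∷ π) → Ins j a π σ →
                 No213 ((x ⊓ s) ∷ σ) → No213 (s ∷ x ∷ σ)
    no213-keep {s = s} {x} {π} {σ} j<s j<@(j<x ∷ j<π) free i freeσ {y = y} {z} x<y y<z sub
      with m≤n⇒m<n∨m≡n (All.head (All.tail (All-resp-⊆ sub j≤)))
      where
      j≤ : All (j ≤_) (s ∷ x ∷ σ)
      j≤ = <⇒≤ j<s ∷ <⇒≤ j<x ∷ Ins-all ≤-refl (All.map <⇒≤ j<π) i
    ... | inj₁ j<x′ = free x<y y<z
      (restrict (keep-any (keep-any i)) (<-trans j<x′ x<y ∷ j<x′ ∷ <-trans j<x′ (<-trans x<y y<z) ∷ []) sub)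
    ... | inj₂ refl = after-j sub
      where
      after-j : ¬ (y ∷ j ∷ z ∷ [] ⊆ s ∷ x ∷ σ)
      after-j (refl ∷ sub′) =
        freeσ (⊓-glb j<x j<s) (≤-<-trans (m⊓n≤n x s) y<z) (refl ∷ drop-≢ (<⇒≢ j<x) sub′)
      after-j (_ ∷ʳ (refl ∷ sub′)) =
        freeσ (⊓-glb j<x j<s) (≤-<-trans (m⊓n≤m x s) y<z) (refl ∷ sub′)
      after-j (_ ∷ʳ (_ ∷ʳ sub′)) = freeσ x<y y<z (_ ∷ʳ sub′)

    no213-front : ∀ {s σ} → All (_≤ s) σ → All (j ≤_) σ → No213 (s ∷ σ) → No213 (s ∷ j ∷ σ)
    no213-front ≤s j≤ free x<y y<z (_ ∷ʳ (_ ∷ʳ sub))   = free x<y y<z (_ ∷ʳ sub)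
    no213-front ≤s j≤ free x<y y<z (_ ∷ʳ (refl ∷ sub)) = <⇒≱ x<y (All.head (All-resp-⊆ sub j≤))
    no213-front ≤s j≤ free x<y y<z (refl ∷ (_ ∷ʳ sub)) = free x<y y<z (refl ∷ sub)
    no213-front ≤s j≤ free x<y y<z (refl ∷ refl ∷ sub) = <⇒≱ y<z (All.head (All-resp-⊆ sub ≤s))

    no213-below : ∀ {a s π σ} → j < s → Ins j a π σ → No213 (s ∷ j ∷ σ) → All (_≤ s) π
    no213-below j<s i free = All.tabulate λ c∈ → ≮⇒≥ λ s<c →
      free j<s s<c (refl ∷ refl ∷ ⊆-trans (from∈ c∈) (Ins-⊆ i))

    -- Behind a copy of `j` the running minimum is `j`, so a site is active only if nothing but
    -- copies of `j` follows.
    inner-j-keep : ∀ {x} σ → j < x → inner j (x ∷ σ) ≡ inner j σ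
    inner-j-keep {x} σ j<x =
      trans (inner-not-below {σ = σ} (<⇒≱ j<x ∘ All.head)) (cong (λ r → inner r σ) (m≥n⇒m⊓n≡n (<⇒≤ j<x)))

    inner-j-zero : ∀ {π} → All (j <_) π → inner j π ≡ 0
    inner-j-zero []                  = refl
    inner-j-zero (_∷_ {xs = π} j<x j<π) = trans (inner-j-keep π j<x) (inner-j-zero j<π)

    inner-j-repeat : ∀ {a x π σ} → j < x → Ins j a (x ∷ π) σ → inner j (j ∷ σ) ≡ inner j σ
    inner-j-repeat {σ = σ} j<x i =
      trans (inner-not-below (λ ≤j → <⇒≱ j<x (All.head (All-resp-⊆ (Ins-⊆ (put i)) ≤j))))
        (cong (λ r → inner r σ) (⊓-idem j))

    inner-replicate : ∀ {s} → j ≤ s → ∀ n → inner s (replicate n j) ≡ n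
    inner-replicate j≤s zero    = refl
    inner-replicate j≤s (suc n) =
      trans (inner-below (replicate⁺ (suc n) j≤s))
        (cong suc (trans (cong (λ r → inner r (replicate n j)) (m≤n⇒m⊓n≡m j≤s)) (inner-replicate ≤-refl n)))

    no213-replicate : ∀ {s} → j ≤ s → ∀ n → No213 (s ∷ replicate n j)
    no213-replicate j≤s n = nonincreasing⇒no213 (replicate⁺ n j≤s ∷ sorted-replicate ≤-refl n)

    no1121-replicate : ∀ n → No1121 (replicate n j)
    no1121-replicate n = proj₂ (Class123.sorted⇒av (sorted-replicate ≤-refl n))

    -- For σ bounded by s this is the weight of j ∷ σ after s; not imposing that
    -- bound lets the letters of σ be peeled off one at a time.
    frontWeight : ℕ → (ℕ → ℕ) → Word → ℕ
    frontWeight s f σ = choose (no213? (s ∷ σ) ×-dec no1121? (j ∷ σ)) (f (suc (suc (inner j σ)))) 0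

    -- The copies form one run followed by larger letters. From here on only the site before the run
    -- and the end are active, hence `f 2`.
    frontWeight-run : ∀ b s f {x π} → All (j <_) (x ∷ π) → All (_≤ s) (x ∷ π) → j < s → AvAfter s (x ∷ π) →
                      insertSum j b (x ∷ π) (frontWeight s f ∘ (j ∷_)) ≡ f 2
    frontWeight-run zero s f {x} {π} j<@(j<x ∷ _) ≤s j<s (free , free′) =
      trans (choose-yes (no213? (s ∷ j ∷ x ∷ π) ×-dec no1121? (j ∷ j ∷ x ∷ π))
              (no213-front ≤s (All.map <⇒≤ j<) free , no1121-front j< free′))
        (cong (f ∘ (2 +_)) (trans (inner-j-repeat j<x (stop {π = x ∷ π})) (inner-j-zero j<)))
    frontWeight-run (suc b) s f {x} {π} j<@(j<x ∷ _) ≤s j<s av =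
      trans (cong₂ _+_
              (trans (insertSum-cong {j} {b} {x ∷ π} repeat) (frontWeight-run b s f j< ≤s j<s av))
              (insertSum-zero {j} {suc b} {π} (λ {σ} i →
                choose-no (no213? (s ∷ j ∷ x ∷ σ) ×-dec no1121? (j ∷ j ∷ x ∷ σ)) (no1121-blocked j<x i ∘ proj₂))))
        (+-identityʳ _)
      where
      repeat : ∀ {σ} → Ins j b (x ∷ π) σ → frontWeight s f (j ∷ j ∷ σ) ≡ frontWeight s f (j ∷ σ)
      repeat {σ} i =
        choose-cong (no213? (s ∷ j ∷ j ∷ σ) ×-dec no1121? (j ∷ j ∷ j ∷ σ)) (no213? (s ∷ j ∷ σ) ×-dec no1121? (j ∷ j ∷ σ))
          (λ (p , q) → no213-⊆ (refl ∷ j ∷ʳ ⊆-refl) p , no1121-⊆ (j ∷ʳ ⊆-refl) q)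
          (λ (p , q) → no213-front (Ins-all (<⇒≤ j<s) ≤s (put i)) (Ins-all ≤-refl (All.map <⇒≤ j<) (put i)) p ,
                       no1121-repeat q)
          (λ _ → cong (f ∘ (2 +_)) (inner-j-repeat j<x (put i)))
          (λ _ → refl)

    -- All remaining copies at the end produce `f (suc (suc (suc b)))`; each of the `inner s π`
    -- active sites before the end contributes the same value `f 2`.
    frontWeight-sum : ∀ b s f {π} → j < s → All (j <_) π → AvAfter s π →
            insertSum j (suc b) π (frontWeight s f) ≡ f (suc (suc (suc b))) + sumFrom2 (const (f 2)) (inner s π)
    frontWeight-sum b s f {[]} j<s _ _ =
      trans (insertSum-[] b)
        (trans (choose-yes (no213? (s ∷ j ∷ replicate b j) ×-dec no1121? (j ∷ j ∷ replicate b j))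
                 (no213-replicate (<⇒≤ j<s) (suc b) , no1121-replicate (suc (suc b))))
          (trans (cong (f ∘ (2 +_)) (inner-replicate ≤-refl (suc b))) (sym (+-identityʳ _))))
    frontWeight-sum b s f {x ∷ π} j<s j<@(j<x ∷ j<π) av@(free , free′) =
      trans (cong (insertSum j b (x ∷ π) (frontWeight s f ∘ (j ∷_)) +_)
              (trans (insertSum-cong {j} {suc b} {π} keep-frontWeight)
                (frontWeight-sum b (x ⊓ s) f (⊓-glb j<x j<s) j<π (avAfter-tail av))))
        (front (below? s (x ∷ π)))
      where
      rest : ℕ
      rest = f (suc (suc (suc b))) + sumFrom2 (const (f 2)) (inner (x ⊓ s) π)

      keep-frontWeight : ∀ {σ} → Ins j (suc b) π σ → frontWeight s f (x ∷ σ) ≡ frontWeight (x ⊓ s) f σ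
      keep-frontWeight {σ} i =
        choose-cong (no213? (s ∷ x ∷ σ) ×-dec no1121? (j ∷ x ∷ σ)) (no213? ((x ⊓ s) ∷ σ) ×-dec no1121? (j ∷ σ))
          (λ (p , q) → no213-⊆ (⊓-∷-⊆ s x σ) p , no1121-⊆ (refl ∷ x ∷ʳ ⊆-refl) q)
          (λ (p , q) → no213-keep j<s j< free i p , no1121-keep-front j< free′ i q)
          (λ _ → cong (f ∘ (2 +_)) (inner-j-keep σ j<x)) (λ _ → refl)

      front : Dec (All (_≤ s) (x ∷ π)) →
                        insertSum j b (x ∷ π) (frontWeight s f ∘ (j ∷_)) + rest ≡
              f (suc (suc (suc b))) + sumFrom2 (const (f 2)) (inner s (x ∷ π))
      front (yes ≤s) =
        trans (cong (_+ rest) (frontWeight-run b s f j< ≤s j<s av))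
          (trans (rotate (f 2) (f (suc (suc (suc b)))) _)
            (cong (λ n → f (suc (suc (suc b))) + sumFrom2 (const (f 2)) n) (sym (inner-below ≤s))))
        where
        rotate : ∀ x y z → x + (y + z) ≡ y + (z + x)
        rotate = solve-∀
      front (no ≰s) =
        cong₂ _+_ (insertSum-zero {j} {b} {x ∷ π} (λ {σ} i →
                    choose-no (no213? (s ∷ j ∷ σ) ×-dec no1121? (j ∷ j ∷ σ)) (≰s ∘ no213-below j<s i ∘ proj₁)))
          (cong (λ n → f (suc (suc (suc b))) + sumFrom2 (const (f 2)) n) (sym (inner-not-below ≰s)))

    frontWeight-total : ∀ a s f {x π} → j < s → All (j <_) (x ∷ π) → AvAfter s (x ∷ π) →
              insertSum j a (x ∷ π) (frontWeight s f) ≡ f (suc (suc a)) + extra a (const (f 2)) (inner s (x ∷ π))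
    frontWeight-total zero s f {x} {π} j<s j< (free , free′) =
      trans (choose-yes (no213? (s ∷ x ∷ π) ×-dec no1121? (j ∷ x ∷ π))
              (free , no1121-⊆ (j ∷ʳ ⊆-refl) (no1121-front j< free′)))
        (trans (cong (f ∘ (2 +_)) (inner-j-zero j<)) (sym (+-identityʳ _)))
    frontWeight-total (suc b) s f j<s j< av = frontWeight-sum b s f j<s j< av

    insert-avAfter : ∀ a s f {π} → j < s → All (j <_) π → AvAfter s π →
                     insertSum j (suc a) π (weightAfter s f) ≡ children a f (suc (inner s π))
    insert-avAfter a s f {[]} j<s _ _ =
      trans (insertSum-[] a)
        (trans (choose-yes (avAfter? s (j ∷ replicate a j))
                 (no213-replicate (<⇒≤ j<s) (suc a) , no1121-replicate (suc a)))
          (trans (cong (f ∘ suc) (trans (inner-replicate (<⇒≤ j<s) (suc a)) (cong suc (sym (+-identityʳ a)))))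
            (sym (children-1 a f))))
    insert-avAfter a s f {x ∷ π} j<s j<@(j<x ∷ j<π) av@(free , free′) = step (below? s (x ∷ π))
      where
      rest : ∀ {σ} f → Ins j (suc a) π σ → ∀ {g} → (AvAfter (x ⊓ s) σ → g ≡ f (suc (inner (x ⊓ s) σ))) →
             choose (avAfter? s (x ∷ σ)) g 0 ≡ weightAfter (x ⊓ s) f σ
      rest {σ} f i g≡ =
        choose-cong (avAfter? s (x ∷ σ)) (avAfter? (x ⊓ s) σ) avAfter-tail
          (λ (p , q) → no213-keep j<s j< free i p , no1121-keep j< free′ i q) g≡ (λ _ → refl)

      induction : ∀ f → insertSum j (suc a) π (weightAfter (x ⊓ s) f) ≡ children a f (suc (inner (x ⊓ s) π))
      induction f = insert-avAfter a (x ⊓ s) f (⊓-glb j<x j<s) j<π (avAfter-tail av)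

      step : Dec (All (_≤ s) (x ∷ π)) →
             insertSum j (suc a) (x ∷ π) (weightAfter s f) ≡ children a f (suc (inner s (x ∷ π)))
      step (yes ≤s) =
        trans (cong₂ _+_ (trans (insertSum-cong {j} {a} {x ∷ π} to-frontWeight) (frontWeight-total a s f j<s j< av))
                -- The site before `x` is active in all these words and adds one to each label.
                (trans (insertSum-cong {j} {suc a} {π} keep-weight) (induction (f ∘ suc))))
          (trans (cong (λ m → (f (suc (suc a)) + extra a (const (f 2)) (inner s (x ∷ π))) + children a (f ∘ suc) m)
                   (sym (inner-below ≤s)))
            (sym (children-shift a f (inner s (x ∷ π)))))
        where
        to-frontWeight : ∀ {σ} → Ins j a (x ∷ π) σ → weightAfter s f (j ∷ σ) ≡ frontWeight s f σ
        to-frontWeight {σ} i =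
          choose-cong (avAfter? s (j ∷ σ)) (no213? (s ∷ σ) ×-dec no1121? (j ∷ σ))
            (λ (p , q) → no213-⊆ (refl ∷ j ∷ʳ ⊆-refl) p , q)
            (λ (p , q) → no213-front σ≤s (Ins-all ≤-refl (All.map <⇒≤ j<) i) p , q)
            (λ _ → cong (f ∘ suc) (trans (inner-below (<⇒≤ j<s ∷ σ≤s))
                      (cong (λ r → suc (inner r σ)) (m≤n⇒m⊓n≡m (<⇒≤ j<s)))))
            (λ _ → refl)
          where
          σ≤s : All (_≤ s) σ
          σ≤s = Ins-all (<⇒≤ j<s) ≤s i
        keep-weight : ∀ {σ} → Ins j (suc a) π σ → weightAfter s f (x ∷ σ) ≡ weightAfter (x ⊓ s) (f ∘ suc) σ
        keep-weight i = rest (f ∘ suc) i λ _ →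
          cong (f ∘ suc) (inner-below (All.head ≤s ∷ Ins-all (<⇒≤ j<s) (All.tail ≤s) i))
      step (no ≰s) =
        cong₂ _+_ (insertSum-zero {j} {a} {x ∷ π} (λ {σ} i →
                    choose-no (avAfter? s (j ∷ σ)) (≰s ∘ no213-below j<s i ∘ proj₁)))
          (trans (insertSum-cong {j} {suc a} {π} keep-weight)
            (trans (induction f) (cong (children a f ∘ suc) (sym (inner-not-below ≰s)))))
        where
        keep-weight : ∀ {σ} → Ins j (suc a) π σ → weightAfter s f (x ∷ σ) ≡ weightAfter (x ⊓ s) f σ
        keep-weight i = rest f i λ _ →
          cong (f ∘ suc) (inner-not-below (≰s ∘ All-resp-⊆ (refl ∷ Ins-⊆ i)))

    insert-av : ∀ a f {π} → All (j <_) π → Av π →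
                insertSum j (suc a) π (λ σ → choose (av? σ) (f (act σ)) 0) ≡ children a f (act π)
    insert-av a f {π} j< av =
      trans (insertSum-cong {j} {suc a} {π} to-after)
        (trans (insert-avAfter a s f j<s j< (bounded π≤s av))
          (cong (children a f ∘ suc) (inner-bound π≤s (xs≤max 0 π))))
      where
      s : ℕ
      -- Starting from `suc j` ensures `j < s` even when `π` is empty.
      s = max (suc j) π
      j<s : j < s
      j<s = v≤max⁺ (suc j) π (inj₁ ≤-refl)
      π≤s : All (_≤ s) π
      π≤s = xs≤max (suc j) π
      bounded : ∀ {σ} → All (_≤ s) σ → Av σ → AvAfter s σ
      bounded {σ} σ≤s (free , free′) = free-s , free′
        where
        free-s : No213 (s ∷ σ)
        free-s x<y y<z (_ ∷ʳ sub)   = free x<y y<z sub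
        free-s x<y y<z (refl ∷ sub) = <⇒≱ y<z (All.head (All.tail (All-resp-⊆ sub σ≤s)))
      to-after : ∀ {σ} → Ins j (suc a) π σ → choose (av? σ) (f (act σ)) 0 ≡ weightAfter s f σ
      to-after {σ} i =
        choose-cong (av? σ) (avAfter? s σ) (bounded σ≤s) (λ (p , q) → no213-⊆ (s ∷ʳ ⊆-refl) p , q)
          (λ _ → cong (f ∘ suc) (inner-bound (xs≤max 0 σ) σ≤s)) (λ _ → refl)
        where
        σ≤s : All (_≤ s) σ
        σ≤s = Ins-all (<⇒≤ j<s) π≤s i

  tree : GeneratingTree (p213 ∷ p1121 ∷ [])
  tree = generatingTree (avoidsAll-pair avoids-213 avoids-1121) av? act
    ((λ _ _ ()) , (λ _ ())) refl
    (λ π⊆σ (p , q) → no213-⊆ π⊆σ p , no1121-⊆ π⊆σ q) insert-av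

theorem2p17 : let P = (1 ∷ 2 ∷ 3 ∷ []) ∷ (1 ∷ 1 ∷ 2 ∷ 1 ∷ []) ∷ []
                  Q = (1 ∷ 3 ∷ 2 ∷ []) ∷ (1 ∷ 2 ∷ 1 ∷ 1 ∷ []) ∷ []
                  R = (2 ∷ 1 ∷ 3 ∷ []) ∷ (1 ∷ 1 ∷ 2 ∷ 1 ∷ []) ∷ []
    in (P ∼ Q) × (Q ∼ R) × (P ∼ R)
theorem2p17 =
  tree⇒∼ Class123.tree Class132.tree ,
  tree⇒∼ Class132.tree Class213.tree ,
  tree⇒∼ Class123.tree Class213.tree
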